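{- Let $A \ge B \ge C \ge 1$ be integers, $e := A+B+C-3$, and $R = \mathbb{Z}[x,y,z]/(x^A,y^B,z^C)$ with its standard grading. Let $U_r : R_r \to R_{r+1}$ be multiplication by $x+y+z$, written as an integer matrix with respect to the monomial bases (the nonzero monomials $x^iy^jz^k$, $i<A$, $j<B$, $k<C$, of degrees $r$ and $r+1$). For $A-1 \le r \le \lfloor \frac{e-1}{2}\rfloor$, define the $(B+C-r-2)\times(r-A+2)$ integer matrix $$M_r(A,B,C) := \left( \binom{A}{r-B+i-j+2} \right)_{1\le i\le B+C-r-2,\ 1\le j\le r-A+2},$$ where $\binom{A}{t}=0$ if $t<0$ or $t>A$. Then for $A-1 \le r \le \lfloor \frac{e-1}{2}\rfloor$, the non-unit entries (i.e., entries other than $\pm1$) of the Smith normal form of $U_r$ coincide, as a multiset up to sign, with the non-unit entries of the Smith normal form of $M_r(A,B,C)$. In particular, the Smith normal form of $U_r$ has at most $r-A+2$ non-unit entries, and for every field $\Bbbk$ the map given by multiplication by $x+y+z$ from the degree-$r$ to the degree-$(r+1)$ component of $\Bbbk[x,y,z]/(x^A,y^B,z^C)$ has nullity at most $r-A+2$.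
   Context: For an integer matrix $U$, its Smith normal form is the diagonal matrix $PUQ$ with $P,Q$ invertible over $\mathbb{Z}$ and diagonal entries $a_1\mid a_2\mid\cdots$; its entries are well defined up to sign. -}

module Defs where

open import Level using (Level; _⊔_) renaming (suc to lsuc)
open import Data.Bool using (Bool; true; false; if_then_else_; _∧_; _∨_)
open import Data.Nat as ℕ using (ℕ; zero; suc; _+_; _∸_; _⊓_; _≡ᵇ_)
open import Data.Nat.Combinatorics using () renaming (_C_ to binom)
open import Data.Integer as ℤ using (ℤ; +_; -[1+_]; ∣_∣)
open import Data.Integer.Divisibility using () renaming (_∣_ to _∣ℤ_)
open import Data.Fin using (Fin; zero; suc; toℕ)
open import Data.List using (List; []; _∷_; length; filter; map; concatMap; upTo; lookup)
open import Data.List.Relation.Unary.Linked using (Linked)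
open import Data.Product using (Σ; ∃; _×_; _,_)
open import Relation.Nullary using (¬_)
open import Relation.Nullary.Decidable using (¬?)
open import Relation.Binary.PropositionalEquality using (_≡_)
open import Algebra.Bundles using (CommutativeRing)

Matrix : ∀ {a} → Set a → ℕ → ℕ → Set a
Matrix X m n = Fin m → Fin n → X

sumWith : ∀ {a} {X : Set a} → (X → X → X) → X → ∀ {n} → (Fin n → X) → X
sumWith _⊕_ o {zero}  f = o
sumWith _⊕_ o {suc n} f = f zero ⊕ sumWith _⊕_ o (λ i → f (suc i))

sumℤ : ∀ {n} → (Fin n → ℤ) → ℤ
sumℤ = sumWith ℤ._+_ (+ 0)

_·_ : ∀ {m n p} → Matrix ℤ m n → Matrix ℤ n p → Matrix ℤ m p
(M · N) i k = sumℤ (λ j → M i j ℤ.* N j k)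

idMat : ∀ {n} → Matrix ℤ n n
idMat i j = if toℕ i ≡ᵇ toℕ j then + 1 else + 0

InvertibleℤMat : ∀ {n} → Matrix ℤ n n → Set
InvertibleℤMat {n} P = Σ (Matrix ℤ n n) λ P' →
  (∀ i j → (P · P') i j ≡ idMat i j) × (∀ i j → (P' · P) i j ≡ idMat i j)

nth : List ℤ → ℕ → ℤ
nth []       _       = + 0
nth (a ∷ as) zero    = a
nth (a ∷ as) (suc k) = nth as k

diagMat : ∀ {m n} → List ℤ → Matrix ℤ m n
diagMat ds i j = if toℕ i ≡ᵇ toℕ j then nth ds (toℕ i) else + 0

IsSNF : ∀ {m n} → Matrix ℤ m n → List ℤ → Set
IsSNF {m} {n} U ds =
  length ds ≡ m ⊓ n ×
  Linked _∣ℤ_ ds ×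
  Σ (Matrix ℤ m m) λ P → Σ (Matrix ℤ n n) λ Q →
    InvertibleℤMat P × InvertibleℤMat Q ×
    (∀ i j → ((P · U) · Q) i j ≡ diagMat ds i j)

nonUnits : List ℤ → List ℕ
nonUnits ds = map ∣_∣ (filter (λ a → ¬? (∣ a ∣ ℕ.≟ 1)) ds)

Mon : Set
Mon = ℕ × ℕ × ℕ    -- (i , j , k) stands for x^i y^j z^k

monos : ℕ → ℕ → ℕ → ℕ → List Mon
monos A B C r =
  filter (λ { (i , j , k) → (i + j + k) ℕ.≟ r })
    (concatMap (λ i → concatMap (λ j → map (λ k → (i , j , k)) (upTo C)) (upTo B)) (upTo A))

dimR : ℕ → ℕ → ℕ → ℕ → ℕ
dimR A B C r = length (monos A B C r)

basis : ∀ A B C r → Fin (dimR A B C r) → Mon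
basis A B C r = lookup (monos A B C r)

mulStep : Mon → Mon → Bool
mulStep (i' , j' , k') (i , j , k) =
  ((i' ≡ᵇ suc i) ∧ (j' ≡ᵇ j) ∧ (k' ≡ᵇ k)) ∨
  ((i' ≡ᵇ i) ∧ (j' ≡ᵇ suc j) ∧ (k' ≡ᵇ k)) ∨
  ((i' ≡ᵇ i) ∧ (j' ≡ᵇ j) ∧ (k' ≡ᵇ suc k))

-- matrix of multiplication by x+y+z : R_r → R_{r+1} in the monomial bases,
-- with coefficients in a ring with given zero o and one l
UMatOver : ∀ {a} {X : Set a} → X → X → ∀ A B C r →
           Matrix X (dimR A B C (suc r)) (dimR A B C r)
UMatOver o l A B C r a b =
  if mulStep (basis A B C (suc r) a) (basis A B C r b) then l else o

U : ∀ A B C r → Matrix ℤ (dimR A B C (suc r)) (dimR A B C r)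
U = UMatOver (+ 0) (+ 1)

-- binom(A, t) for an integer t, 0 if t < 0 (and binom is 0 for t > A)
binomℤ : ℕ → ℤ → ℤ
binomℤ A (+ t)     = + (binom A t)
binomℤ A -[1+ t ]  = + 0

-- entry (i,j), 1-based, is binom(A, r-B+i-j+2); here i, j are 0-based Fin indices
M : ∀ A B C r → Matrix ℤ (B + C ∸ (r + 2)) (r + 2 ∸ A)
M A B C r i j = binomℤ A ((+ (r + 2 + toℕ i)) ℤ.- (+ (B + toℕ j)))

record Field (c ℓ : Level) : Set (lsuc (c ⊔ ℓ)) where
  field
    commutativeRing : CommutativeRing c ℓ
  open CommutativeRing commutativeRing public
  field
    0≉1     : ¬ (0# ≈ 1#)
    inverse : ∀ x → ¬ (x ≈ 0#) → Σ Carrier λ y → x * y ≈ 1#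

module _ {c ℓ} (K : Field c ℓ) where
  open Field K using (Carrier; _≈_; 0#; 1#) renaming (_+_ to _+K_; _*_ to _*K_)

  sumK : ∀ {n} → (Fin n → Carrier) → Carrier
  sumK = sumWith _+K_ 0#

  LinIndep : ∀ {s n} → (Fin s → Fin n → Carrier) → Set (c ⊔ ℓ)
  LinIndep {s} {n} v = ∀ (λs : Fin s → Carrier) →
    (∀ b → sumK (λ t → λs t *K v t b) ≈ 0#) → ∀ t → λs t ≈ 0#

  NullityAtMost : ∀ {m n} → Matrix Carrier m n → ℕ → Set (c ⊔ ℓ)
  NullityAtMost {m} {n} W k = ∀ s (v : Fin s → Fin n → Carrier) →
    (∀ t a → sumK (λ b → W a b *K v t b) ≈ 0#) → LinIndep v → s ℕ.≤ k

  UK : ∀ A B C r → Matrix Carrier (dimR A B C (suc r)) (dimR A B C r)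
  UK = UMatOver 0# 1#

{-# OPTIONS --safe #-}
module Submission where

-- Write ℓ = y+z and f = Σ xⁱ fᵢ.  If the coefficients of x¹, …, x^{A-1} in (x+y+z)f vanish
-- (possibly modulo d), then fᵢ = -ℓ fᵢ₊₁, so f is determined by its top slice g = f_{A-1},
-- a form of degree r-A+1, and the remaining coefficient of x⁰ is -(-ℓ)^A g, whose
-- coefficients are the binomial sums M_r g up to sign.  This bounds every nullity by r-A+2.
-- The Smith entries d_k of U and d'_k of M are compared through primitive vectors w ∈ ℤⁿ.
-- If the first k Smith coordinates of w vanish then d_k divides Uw; if those after the k-th
-- vanish and d divides Uw, then d divides d_k w, hence d divides d_k.  With n = q + (r-A+2),
-- imposing fewer than n linear conditions on w (on Smith coordinates of w, on those of g,
-- or on the coefficients of (x+y+z)f) gives in turn d_k ∣ 1 for k < q, d_{q+k} ∣ d'_k and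
-- d'_k ∣ d_{q+k}.

open import Defs
open import Level using (Level; _⊔_) renaming (suc to lsuc)
open import Algebra.Bundles using (CommutativeRing)
open import Data.Bool using (Bool; true; false; if_then_else_; T; _∧_; _∨_)
open import Data.Empty using (⊥-elim)
open import Data.Fin using (Fin; zero; suc; toℕ; fromℕ<; inject≤; punchIn)
open import Data.Fin.Properties using (toℕ-injective; toℕ-fromℕ<; toℕ-inject≤; toℕ<n; toℕ≤pred[n]; injective⇒≤; punchInᵢ≢i)
open import Data.List using (List; []; _∷_; length; filter; map; concatMap; upTo; applyUpTo; lookup; _++_)
open import Data.List.Membership.Propositional using (_∈_; find)
open import Data.List.Membership.Propositional.Properties using (∈-map⁺; ∈-map⁻; ∈-concatMap⁺; ∈-concatMap⁻; ∈-upTo⁺; ∈-upTo⁻; ∈-filter⁺; ∈-filter⁻; ∈-lookup; ∈-++⁺ˡ; ∈-++⁺ʳ; ∈-++⁻)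
open import Data.List.Properties using (length-map; length-++; length-applyUpTo; length-upTo; length-filter; filter-reject; filter-accept)
open import Data.List.Relation.Binary.Permutation.Propositional using (_↭_; ↭-reflexive)
open import Data.List.Relation.Unary.All as All using (All; []; _∷_)
import Data.List.Relation.Unary.All.Properties as All
open import Data.List.Relation.Unary.AllPairs as AllPairs using ([]; _∷_)
import Data.List.Relation.Unary.AllPairs.Properties as AllPairs
open import Data.List.Relation.Unary.Any as Any using ()
open import Data.List.Relation.Unary.Any.Properties using (lookup-index)
open import Data.List.Relation.Unary.Linked using (Linked; []; _∷_)
open import Data.List.Relation.Unary.Unique.Propositional using (Unique)
import Data.List.Relation.Unary.Unique.Propositional.Properties as Unique
open import Data.Nat as ℕ using (ℕ; zero; suc; z≤n; s≤s; _≡ᵇ_)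
open import Data.Nat.Combinatorics using (nCk+nC[k+1]≡[n+1]C[k+1]; k>n⇒nCk≡0) renaming (_C_ to binom)
import Data.Nat.Divisibility as ℕ
open import Data.Nat.GCD using (gcd; gcd[m,n]∣m; gcd[m,n]∣n; gcd-greatest; c*gcd[m,n]≡gcd[cm,cn])
import Data.Nat.Properties as ℕ
open import Data.Nat.Solver using (module +-*-Solver)
open import Data.Product using (Σ; ∃; _×_; _,_; proj₁; proj₂)
open import Data.Sum using (_⊎_; inj₁; inj₂)
open import Data.Unit using (tt)
open import Data.Vec.Functional using (insertAt; removeAt)
open import Data.Vec.Functional.Properties using (insertAt-lookup; insertAt-punchIn)
open import Function using (_∘_; Injective)
open import Relation.Binary.PropositionalEquality as ≡ using (_≡_; _≢_)
open import Relation.Nullary using (¬_; yes; no; Dec; contradiction)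
open import Relation.Nullary.Decidable using (¬?; decidable-stable)
open +-*-Solver using (solve; _:+_; _:*_; _:=_; con)

-- Sums, pairings, ideals and kernels of linear conditions over a commutative ring.

module LinearAlgebra {c ℓ} (R : CommutativeRing c ℓ) where
  open CommutativeRing R hiding (zero)
  open import Algebra.Properties.Ring ring using (-1*x≈-x; -‿distribˡ-*; -‿distribʳ-*)
  open import Algebra.Properties.Semiring.Sum semiring as Sum using ()
  open import Relation.Binary.Reasoning.Setoid setoid

  ∑ : ∀ {n} → (Fin n → Carrier) → Carrier
  ∑ = sumWith _+_ 0#

  ∑≡sum : ∀ {n} (f : Fin n → Carrier) → ∑ f ≡ Sum.sum f
  ∑≡sum {zero}  f = ≡.refl
  ∑≡sum {suc n} f = ≡.cong (f zero +_) (∑≡sum (f ∘ suc))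

  ∑-cong : ∀ {n} {f g : Fin n → Carrier} → (∀ i → f i ≈ g i) → ∑ f ≈ ∑ g
  ∑-cong {zero}  f≈g = refl
  ∑-cong {suc n} f≈g = +-cong (f≈g zero) (∑-cong (f≈g ∘ suc))

  ∑-zero : ∀ {n} {f : Fin n → Carrier} → (∀ i → f i ≈ 0#) → ∑ f ≈ 0#
  ∑-zero {zero}  f≈0 = refl
  ∑-zero {suc n} f≈0 = trans (+-cong (f≈0 zero) (∑-zero (f≈0 ∘ suc))) (+-identityˡ 0#)

  ∑-remove : ∀ {n} (p : Fin (suc n)) (f : Fin (suc n) → Carrier) → ∑ f ≈ f p + ∑ (f ∘ punchIn p)
  ∑-remove p f = begin
    ∑ f                          ≡⟨ ∑≡sum f ⟩
    Sum.sum f                    ≈⟨ Sum.sum-remove {i = p} f ⟩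
    f p + Sum.sum (removeAt f p) ≡⟨ ≡.cong (f p +_) (∑≡sum (f ∘ punchIn p)) ⟨
    f p + ∑ (f ∘ punchIn p)      ∎

  ∑-single : ∀ {n} (p : Fin n) {f : Fin n → Carrier} → (∀ i → i ≢ p → f i ≈ 0#) → ∑ f ≈ f p
  ∑-single {suc n} p {f} f≈0 = begin
    ∑ f                     ≈⟨ ∑-remove p f ⟩
    f p + ∑ (f ∘ punchIn p) ≈⟨ +-congˡ (∑-zero (λ i → f≈0 (punchIn p i) (punchInᵢ≢i p i))) ⟩
    f p + 0#                ≈⟨ +-identityʳ (f p) ⟩
    f p                     ∎

  ∑-+ : ∀ {n} (f g : Fin n → Carrier) → ∑ (λ i → f i + g i) ≈ ∑ f + ∑ g
  ∑-+ f g = begin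
    ∑ (λ i → f i + g i)       ≡⟨ ∑≡sum (λ i → f i + g i) ⟩
    Sum.sum (λ i → f i + g i) ≈⟨ Sum.∑-distrib-+ f g ⟩
    Sum.sum f + Sum.sum g     ≡⟨ ≡.cong₂ _+_ (∑≡sum f) (∑≡sum g) ⟨
    ∑ f + ∑ g                 ∎

  ∑-*ˡ : ∀ {n} x (f : Fin n → Carrier) → x * ∑ f ≈ ∑ (λ i → x * f i)
  ∑-*ˡ x f = begin
    x * ∑ f               ≡⟨ ≡.cong (x *_) (∑≡sum f) ⟩
    x * Sum.sum f         ≈⟨ Sum.*-distribˡ-sum x f ⟩
    Sum.sum (λ i → x * f i) ≡⟨ ∑≡sum (λ i → x * f i) ⟨
    ∑ (λ i → x * f i)     ∎

  ∑-*ʳ : ∀ {n} x (f : Fin n → Carrier) → ∑ f * x ≈ ∑ (λ i → f i * x)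
  ∑-*ʳ x f = trans (*-comm _ x) (trans (∑-*ˡ x f) (∑-cong (λ i → *-comm x (f i))))

  ∑-swap : ∀ {m n} (f : Fin m → Fin n → Carrier) →
           ∑ (λ i → ∑ (λ j → f i j)) ≈ ∑ (λ j → ∑ (λ i → f i j))
  ∑-swap {zero} {n} f = sym (∑-zero {n} (λ j → refl))
  ∑-swap {suc m} f = trans (+-congˡ (∑-swap (f ∘ suc))) (sym (∑-+ (f zero) _))

  infixl 7 _⋆_
  _⋆_ : ∀ {n} → (Fin n → Carrier) → (Fin n → Carrier) → Carrier
  u ⋆ v = ∑ (λ i → u i * v i)

  ⋆-scaleʳ : ∀ {n} (u : Fin n → Carrier) x v → u ⋆ (λ i → x * v i) ≈ x * (u ⋆ v)
  ⋆-scaleʳ u x v = sym (trans (∑-*ˡ x (λ i → u i * v i)) (∑-cong λ i → begin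
    x * (u i * v i) ≈⟨ *-assoc x (u i) (v i) ⟨
    x * u i * v i   ≈⟨ *-congʳ (*-comm x (u i)) ⟩
    u i * x * v i   ≈⟨ *-assoc (u i) x (v i) ⟩
    u i * (x * v i) ∎))

  ⋆-assoc : ∀ {m n} (u : Fin m → Carrier) (N : Fin m → Fin n → Carrier) (v : Fin n → Carrier) →
            (λ j → u ⋆ (λ i → N i j)) ⋆ v ≈ u ⋆ (λ i → N i ⋆ v)
  ⋆-assoc u N v = begin
    ∑ (λ j → ∑ (λ i → u i * N i j) * v j)   ≈⟨ ∑-cong (λ j → ∑-*ʳ (v j) (λ i → u i * N i j)) ⟩
    ∑ (λ j → ∑ (λ i → u i * N i j * v j))   ≈⟨ ∑-swap (λ j i → u i * N i j * v j) ⟩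
    ∑ (λ i → ∑ (λ j → u i * N i j * v j))   ≈⟨ ∑-cong (λ i → ∑-cong (λ j → *-assoc (u i) (N i j) (v j))) ⟩
    ∑ (λ i → ∑ (λ j → u i * (N i j * v j))) ≈⟨ ∑-cong (λ i → sym (∑-*ˡ (u i) (λ j → N i j * v j))) ⟩
    ∑ (λ i → u i * (N i ⋆ v))               ∎

  -- Working modulo an ideal lets one argument serve twice: with the multiples of d in ℤ for the
  -- Smith entries, and with the zero ideal of a field for the nullity.
  record Ideal p : Set (c ⊔ ℓ ⊔ lsuc p) where
    field
      Mem    : Carrier → Set p
      resp   : ∀ {x y} → x ≈ y → Mem x → Mem y
      0∈     : Mem 0#
      +-clos : ∀ {x y} → Mem x → Mem y → Mem (x + y)
      *-clos : ∀ x {y} → Mem y → Mem (x * y)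

    neg-clos : ∀ {x} → Mem x → Mem (- x)
    neg-clos {x} m = resp (-1*x≈-x x) (*-clos (- 1#) m)

    ∑-clos : ∀ {n} {f : Fin n → Carrier} → (∀ i → Mem (f i)) → Mem (∑ f)
    ∑-clos {zero}  m = 0∈
    ∑-clos {suc n} m = +-clos (m zero) (∑-clos (m ∘ suc))

    cancelʳ : ∀ {x y} → Mem (x + y) → Mem y → Mem x
    cancelʳ {x} {y} mxy my = resp (trans (+-assoc x y (- y))
      (trans (+-congˡ (-‿inverseʳ y)) (+-identityʳ x))) (+-clos mxy (neg-clos my))

  zeroIdeal : Ideal ℓ
  zeroIdeal = record
    { Mem    = _≈ 0#
    ; resp   = λ x≈y x≈0 → trans (sym x≈y) x≈0
    ; 0∈     = refl
    ; +-clos = λ x≈0 y≈0 → trans (+-cong x≈0 y≈0) (+-identityˡ 0#)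
    ; *-clos = λ x y≈0 → trans (*-congˡ y≈0) (zeroʳ x)
    }

  -- Equality need not be decidable, so pivots can only be found up to double negation.
  ¬¬-pivot : ∀ {n} (u : Fin n → Carrier) → ¬ ¬ ((∃ λ p → ¬ u p ≈ 0#) ⊎ (∀ i → u i ≈ 0#))
  ¬¬-pivot {zero}  u k = k (inj₂ λ ())
  ¬¬-pivot {suc n} u k = ¬¬-pivot (u ∘ suc) λ
    { (inj₁ (p , up≉0)) → k (inj₁ (suc p , up≉0))
    ; (inj₂ u≈0) → k (inj₁ (zero , λ u₀≈0 → k (inj₂ λ { zero → u₀≈0 ; (suc i) → u≈0 i })))
    }

  module Kernel (0≉1 : ¬ 0# ≈ 1#) (noZeroDivisors : ∀ {x y} → ¬ x ≈ 0# → ¬ y ≈ 0# → ¬ x * y ≈ 0#) where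

    -- Fraction-free elimination: cross-multiplying with the pivot `u p` clears entry `p` of `v`
    -- without division, so it works over ℤ as well as over a field.
    eliminate : ∀ {n} → Fin (suc n) → (Fin (suc n) → Carrier) → (Fin (suc n) → Carrier) → Fin n → Carrier
    eliminate p u v i = u p * v (punchIn p i) + - (v p * u (punchIn p i))

    -- Back-substitution without division: after the other coordinates are scaled by `u p`, the
    -- equation `u ⋆ w ≈ 0` can be solved for coordinate `p`.
    lift : ∀ {n} → Fin (suc n) → (Fin (suc n) → Carrier) → (Fin n → Carrier) → Fin (suc n) → Carrier
    lift p u w = insertAt (λ i → u p * w i) p (- ((u ∘ punchIn p) ⋆ w))

    -- `lift` is the transpose of `eliminate`, so a solution of the eliminated system lifts to a
    -- solution of the original one.
    ⋆-lift : ∀ {n} (p : Fin (suc n)) u v (w : Fin n → Carrier) → v ⋆ lift p u w ≈ eliminate p u v ⋆ w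
    ⋆-lift p u v w = begin
      v ⋆ lift p u w
        ≈⟨ ∑-remove p (λ i → v i * lift p u w i) ⟩
      v p * lift p u w p + ∑ (λ i → v (punchIn p i) * lift p u w (punchIn p i))
        ≈⟨ +-cong (*-congˡ (reflexive (insertAt-lookup _ p _)))
                  (∑-cong (λ i → *-congˡ (reflexive (insertAt-punchIn _ p _ i)))) ⟩
      v p * (- (u′ ⋆ w)) + ∑ (λ i → v (punchIn p i) * (u p * w i))
        ≈⟨ +-comm _ _ ⟩
      ∑ (λ i → v (punchIn p i) * (u p * w i)) + v p * (- (u′ ⋆ w))
        ≈⟨ +-cong (∑-cong (λ i → trans (sym (*-assoc (v (punchIn p i)) (u p) (w i))) (*-congʳ (*-comm (v (punchIn p i)) (u p))))) (begin
             v p * (- (u′ ⋆ w))           ≈⟨ -‿distribʳ-* _ _ ⟨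
             - (v p * (u′ ⋆ w))           ≈⟨ -‿distribˡ-* _ _ ⟩
             (- v p) * (u′ ⋆ w)           ≈⟨ ∑-*ˡ (- v p) (λ i → u′ i * w i) ⟩
             ∑ (λ i → - v p * (u′ i * w i)) ≈⟨ ∑-cong (λ i → trans (sym (*-assoc (- v p) (u′ i) (w i))) (*-congʳ (sym (-‿distribˡ-* (v p) (u′ i))))) ⟩
             ∑ (λ i → - (v p * u′ i) * w i) ∎) ⟩
      ∑ (λ i → u p * v (punchIn p i) * w i) + ∑ (λ i → - (v p * u′ i) * w i)
        ≈⟨ ∑-+ (λ i → u p * v (punchIn p i) * w i) (λ i → - (v p * u′ i) * w i) ⟨
      ∑ (λ i → u p * v (punchIn p i) * w i + - (v p * u′ i) * w i)
        ≈⟨ ∑-cong (λ i → sym (distribʳ (w i) _ _)) ⟩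
      eliminate p u v ⋆ w ∎
      where u′ = u ∘ punchIn p

    eliminate-self : ∀ {n} (p : Fin (suc n)) u i → eliminate p u u i ≈ 0#
    eliminate-self p u i = -‿inverseʳ _

    NonzeroKernel : ∀ {n} → List (Fin n → Carrier) → Set (c ⊔ ℓ)
    NonzeroKernel {n} rows = Σ (Fin n → Carrier) λ w →
      (∃ λ b → ¬ w b ≈ 0#) × All (λ u → u ⋆ w ≈ 0#) rows

    -- Gaussian elimination. The induction runs on the number of rows because elimination rewrites
    -- the remaining ones. A zero row is dropped; a row with a pivot removes one row and one
    -- unknown.
    ¬¬-kernel′ : ∀ k {n} (rows : List (Fin n → Carrier)) → length rows ≡ k → k ℕ.< n → ¬ ¬ NonzeroKernel rows
    ¬¬-kernel′ zero    {suc n} []         _  _         ¬ker = ¬ker ((λ _ → 1#) , (zero , λ 1≈0 → 0≉1 (sym 1≈0)) , [])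
    ¬¬-kernel′ (suc k) {suc n} (u ∷ rows) eq (s≤s k<n) ¬ker = ¬¬-pivot u λ
      { (inj₂ u≈0) → ¬¬-kernel′ k rows (ℕ.suc-injective eq) (ℕ.m<n⇒m<1+n k<n) λ { (w , w≉0 , rows⋆w≈0) →
          ¬ker (w , w≉0 , ∑-zero {suc n} {λ i → u i * w i} (λ i → trans (*-congʳ (u≈0 i)) (zeroˡ (w i))) ∷ rows⋆w≈0) }
      ; (inj₁ (p , up≉0)) →
          ¬¬-kernel′ k (map (eliminate p u) rows) (≡.trans (length-map _ rows) (ℕ.suc-injective eq)) k<n
            λ { (w , (b , wb≉0) , rows′⋆w≈0) →
              ¬ker ( lift p u w
                   -- The lift scales coordinate `b` to `u p * w b`, which stays nonzero in the
                   -- absence of zero divisors.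
                   , (punchIn p b , λ eq → noZeroDivisors up≉0 wb≉0
                       (trans (reflexive (≡.sym (insertAt-punchIn _ p _ b))) eq))
                   , trans (⋆-lift p u u w)
                       (∑-zero (λ i → trans (*-congʳ (eliminate-self p u i)) (zeroˡ (w i))))
                     ∷ All.map (λ {v} eq → trans (⋆-lift p u v w) eq) (All.map⁻ rows′⋆w≈0)) }
      }

    ¬¬-kernel : ∀ {n} (rows : List (Fin n → Carrier)) → length rows ℕ.< n → ¬ ¬ NonzeroKernel rows
    ¬¬-kernel rows = ¬¬-kernel′ (length rows) rows ≡.refl

-- Multiplication by x+y+z on coefficients.

eqMon : Mon → Mon → Bool
eqMon (i′ , j′ , k′) (i , j , k) = (i′ ≡ᵇ i) ∧ (j′ ≡ᵇ j) ∧ (k′ ≡ᵇ k)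

∧-true : ∀ {a b} → a ∧ b ≡ true → a ≡ true × b ≡ true
∧-true {true} eq = ≡.refl , eq

≡ᵇ-true : ∀ m n → (m ≡ᵇ n) ≡ true → m ≡ n
≡ᵇ-true m n eq = ℕ.≡ᵇ⇒≡ m n (≡.subst T (≡.sym eq) tt)

≡ᵇ-refl : ∀ n → (n ≡ᵇ n) ≡ true
≡ᵇ-refl zero    = ≡.refl
≡ᵇ-refl (suc n) = ≡ᵇ-refl n

eqMon-true : ∀ s t → eqMon s t ≡ true → s ≡ t
eqMon-true (i′ , j′ , k′) (i , j , k) eq with ∧-true {i′ ≡ᵇ i} eq
... | ei , ejk with ∧-true {j′ ≡ᵇ j} ejk
... | ej , ek = ≡.cong₂ _,_ (≡ᵇ-true i′ i ei) (≡.cong₂ _,_ (≡ᵇ-true j′ j ej) (≡ᵇ-true k′ k ek))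

eqMon-refl : ∀ t → eqMon t t ≡ true
eqMon-refl (i , j , k) rewrite ≡ᵇ-refl i | ≡ᵇ-refl j | ≡ᵇ-refl k = ≡.refl

≡ᵇ-excl : ∀ m n → (m ≡ᵇ suc n) ≡ true → (m ≡ᵇ n) ≢ true
≡ᵇ-excl m n e e′ = ℕ.1+n≢n (≡.trans (≡.sym (≡ᵇ-true m (suc n) e)) (≡ᵇ-true m n e′))

-- Homogeneous elements are handled as power series: truncation by x^A, y^B, z^C is
-- harmless because a coefficient of (x+y+z)f only involves smaller exponents of f.
module Multiplication {c ℓ} (R : CommutativeRing c ℓ) where
  open CommutativeRing R hiding (zero)
  open LinearAlgebra R
  open import Algebra.Properties.AbelianGroup +-abelianGroup using (⁻¹-∙-comm)
  open import Algebra.Properties.CommutativeSemigroup +-commutativeSemigroup using (interchange)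
  open import Relation.Binary.Reasoning.Setoid setoid

  shift : ∀ {a} {X : Set a} → X → (ℕ → X) → ℕ → X
  shift o f zero    = o
  shift o f (suc n) = f n

  mulYZ : (ℕ → ℕ → Carrier) → ℕ → ℕ → Carrier
  mulYZ g j k = shift 0# (λ j′ → g j′ k) j + shift 0# (g j) k

  mulXYZ : (ℕ → ℕ → ℕ → Carrier) → ℕ → ℕ → ℕ → Carrier
  mulXYZ f i j k = shift 0# (λ i′ → f i′ j k) i + mulYZ (f i) j k

  -- The coefficients of (-(y+z))^t g.
  negMulYZ^ : ℕ → (ℕ → ℕ → Carrier) → ℕ → ℕ → Carrier
  negMulYZ^ zero    g     = g
  negMulYZ^ (suc t) g j k = - mulYZ (negMulYZ^ t g) j k

  ind : Bool → Carrier
  ind b = if b then 1# else 0#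

  -- The three disjuncts are the shapes of the tests in `mulStep`. An exponent cannot equal both a
  -- number and its successor, so at most one disjunct holds and indicators add.
  ind-exclusive : ∀ x x′ y y′ z z′ → (x ≡ true → x′ ≢ true) → (y ≡ true → y′ ≢ true) →
    ind ((x ∧ y′ ∧ z′) ∨ (x′ ∧ y ∧ z′) ∨ (x′ ∧ y′ ∧ z)) ≈
    ind (x ∧ y′ ∧ z′) + (ind (x′ ∧ y ∧ z′) + ind (x′ ∧ y′ ∧ z))
  ind-exclusive true  true  y y′ z z′ ex ey = ⊥-elim (ex ≡.refl ≡.refl)
  ind-exclusive true  false y y′ z z′ ex ey with y′ ∧ z′
  ... | true  = sym (trans (+-congˡ (+-identityˡ 0#)) (+-identityʳ 1#))
  ... | false = sym (trans (+-congˡ (+-identityˡ 0#)) (+-identityʳ 0#))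
  ind-exclusive false false y y′ z z′ ex ey = sym (trans (+-congˡ (+-identityˡ 0#)) (+-identityʳ 0#))
  ind-exclusive false true true true z z′ ex ey = ⊥-elim (ey ≡.refl ≡.refl)
  ind-exclusive false true true false z true  ex ey = sym (trans (+-identityˡ _) (+-identityʳ 1#))
  ind-exclusive false true true false z false ex ey = sym (trans (+-identityˡ _) (+-identityʳ 0#))
  ind-exclusive false true false y′ z z′ ex ey = sym (trans (+-identityˡ _) (+-identityˡ _))

  coeff : ∀ {n} → (Fin n → Mon) → Mon → Fin n → Carrier
  coeff pts t b = ind (eqMon t (pts b))

  module _ {n} (pts : Fin n → Mon) (w : Fin n → Carrier) where

    -- The element with coordinates `w` as a power series: its coefficient is 0 at every exponent
    -- triple outside `pts`.
    series : ℕ → ℕ → ℕ → Carrier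
    series i j k = coeff pts (i , j , k) ⋆ w

    series-pts : Injective _≡_ _≡_ pts → ∀ b → coeff pts (pts b) ⋆ w ≈ w b
    series-pts inj b = trans (∑-single b off) on
      where
      off : ∀ i → i ≢ b → ind (eqMon (pts b) (pts i)) * w i ≈ 0#
      off i i≢b with eqMon (pts b) (pts i) in eq
      ... | true  = contradiction (≡.sym (inj (eqMon-true _ _ eq))) i≢b
      ... | false = zeroˡ (w i)
      on : ind (eqMon (pts b) (pts b)) * w b ≈ w b
      on rewrite eqMon-refl (pts b) = *-identityˡ (w b)

    -- A row of `U` paired with `w` is a coefficient of (x+y+z)f. Where an exponent is 0 the
    -- corresponding step is impossible, in agreement with the value 0 of `shift`.
    mulStep-⋆ : ∀ i j k → (λ b → ind (mulStep (i , j , k) (pts b))) ⋆ w ≈ mulXYZ series i j k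
    mulStep-⋆ i j k = begin
      (λ b → ind (mulStep (i , j , k) (pts b))) ⋆ w
        ≈⟨ ∑-cong split ⟩
      ∑ (λ b → sx b * w b + (sy b * w b + sz b * w b))
        ≈⟨ ∑-+ (λ b → sx b * w b) (λ b → sy b * w b + sz b * w b) ⟩
      sx ⋆ w + ∑ (λ b → sy b * w b + sz b * w b)
        ≈⟨ +-cong (shiftx i) (trans (∑-+ (λ b → sy b * w b) (λ b → sz b * w b)) (+-cong (shifty j) (shiftz k))) ⟩
      mulXYZ series i j k ∎
      where
      X Y Z : Fin n → ℕ
      X b = proj₁ (pts b)
      Y b = proj₁ (proj₂ (pts b))
      Z b = proj₂ (proj₂ (pts b))
      sx sy sz : Fin n → Carrier
      sx b = ind ((i ≡ᵇ suc (X b)) ∧ (j ≡ᵇ Y b) ∧ (k ≡ᵇ Z b))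
      sy b = ind ((i ≡ᵇ X b) ∧ (j ≡ᵇ suc (Y b)) ∧ (k ≡ᵇ Z b))
      sz b = ind ((i ≡ᵇ X b) ∧ (j ≡ᵇ Y b) ∧ (k ≡ᵇ suc (Z b)))
      split : ∀ b → ind (mulStep (i , j , k) (pts b)) * w b ≈ sx b * w b + (sy b * w b + sz b * w b)
      split b = begin
        ind (mulStep (i , j , k) (pts b)) * w b
          ≈⟨ *-congʳ (ind-exclusive _ _ _ _ (k ≡ᵇ suc (Z b)) (k ≡ᵇ Z b) (≡ᵇ-excl i (X b)) (≡ᵇ-excl j (Y b))) ⟩
        (sx b + (sy b + sz b)) * w b
          ≈⟨ distribʳ (w b) (sx b) (sy b + sz b) ⟩
        sx b * w b + (sy b + sz b) * w b
          ≈⟨ +-congˡ (distribʳ (w b) (sy b) (sz b)) ⟩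
        sx b * w b + (sy b * w b + sz b * w b) ∎
      false-∧ : ∀ a b → ind (a ∧ b ∧ false) ≈ 0#
      false-∧ true  true  = refl
      false-∧ true  false = refl
      false-∧ false _     = refl
      false-∧′ : ∀ a → ind (a ∧ false) ≈ 0#
      false-∧′ true  = refl
      false-∧′ false = refl
      shiftx : ∀ i → (λ b → ind ((i ≡ᵇ suc (X b)) ∧ (j ≡ᵇ Y b) ∧ (k ≡ᵇ Z b))) ⋆ w ≈ shift 0# (λ i′ → series i′ j k) i
      shiftx zero    = ∑-zero (λ b → zeroˡ (w b))
      shiftx (suc _) = refl
      shifty : ∀ j → (λ b → ind ((i ≡ᵇ X b) ∧ (j ≡ᵇ suc (Y b)) ∧ (k ≡ᵇ Z b))) ⋆ w ≈ shift 0# (λ j′ → series i j′ k) j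
      shifty zero    = ∑-zero (λ b → trans (*-congʳ (false-∧′ (i ≡ᵇ X b))) (zeroˡ (w b)))
      shifty (suc _) = refl
      shiftz : ∀ k → (λ b → ind ((i ≡ᵇ X b) ∧ (j ≡ᵇ Y b) ∧ (k ≡ᵇ suc (Z b)))) ⋆ w ≈ shift 0# (series i j) k
      shiftz zero    = ∑-zero (λ b → trans (*-congʳ (false-∧ (i ≡ᵇ X b) (j ≡ᵇ Y b))) (zeroˡ (w b)))
      shiftz (suc _) = refl

  module _ {p} (I : Ideal p) (B C : ℕ) where
    open Ideal I

    -- The coefficient of y^j z^k in (y+z)g involves g only at smaller exponents, so a congruence
    -- known inside the box j < B, k < C in degree s carries over to degree s+1.
    mulYZ-diff : ∀ {g h} s → (∀ j k → j ℕ.< B → k ℕ.< C → j ℕ.+ k ≡ s → Mem (g j k + - h j k)) →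
      ∀ j k → j ℕ.< B → k ℕ.< C → j ℕ.+ k ≡ suc s → Mem (mulYZ g j k + - mulYZ h j k)
    mulYZ-diff {g} {h} s m j k j<B k<C eq = resp regroup (+-clos (diffʸ j j<B eq) (diffᶻ k k<C eq))
      where
      0-0 : Mem (0# + - 0#)
      0-0 = resp (sym (-‿inverseʳ 0#)) 0∈
      diffʸ : ∀ j → j ℕ.< B → j ℕ.+ k ≡ suc s → Mem (shift 0# (λ j′ → g j′ k) j + - shift 0# (λ j′ → h j′ k) j)
      diffʸ zero    _   _  = 0-0
      diffʸ (suc j) j<B eq = m j k (ℕ.<⇒≤ j<B) k<C (ℕ.suc-injective eq)
      diffᶻ : ∀ k → k ℕ.< C → j ℕ.+ k ≡ suc s → Mem (shift 0# (g j) k + - shift 0# (h j) k)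
      diffᶻ zero    _   _  = 0-0
      diffᶻ (suc k) k<C eq = m j k j<B (ℕ.<⇒≤ k<C) (ℕ.suc-injective (≡.trans (≡.sym (ℕ.+-suc j k)) eq))
      regroup : ∀ {a b c d} → (a + - b) + (c + - d) ≈ (a + c) + - (b + d)
      regroup {a} {b} {c} {d} = trans (interchange a (- b) c (- d)) (+-congˡ (⁻¹-∙-comm b d))

    negMulYZ^-clos : ∀ s g → (∀ j k → j ℕ.< B → k ℕ.< C → j ℕ.+ k ≡ s → Mem (g j k)) → ∀ t →
      ∀ j k → j ℕ.< B → k ℕ.< C → j ℕ.+ k ≡ t ℕ.+ s → Mem (negMulYZ^ t g j k)
    negMulYZ^-clos s g m zero    = m
    negMulYZ^-clos s g m (suc t) j k j<B k<C eq = neg-clos (+-clos (my j j<B eq) (mz k k<C eq))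
      where
      my : ∀ j → j ℕ.< B → j ℕ.+ k ≡ suc (t ℕ.+ s) → Mem (shift 0# (λ j′ → negMulYZ^ t g j′ k) j)
      my zero    _   _  = 0∈
      my (suc j) j<B eq = negMulYZ^-clos s g m t j k (ℕ.<⇒≤ j<B) k<C (ℕ.suc-injective eq)
      mz : ∀ k → k ℕ.< C → j ℕ.+ k ≡ suc (t ℕ.+ s) → Mem (shift 0# (negMulYZ^ t g j) k)
      mz zero    _   _  = 0∈
      mz (suc k) k<C eq = negMulYZ^-clos s g m t j k j<B (ℕ.<⇒≤ k<C)
        (ℕ.suc-injective (≡.trans (≡.sym (ℕ.+-suc j k)) eq))

    module _ (A₀ r : ℕ) (f : ℕ → ℕ → ℕ → Carrier)
      (interior : ∀ i j k → i ℕ.< A₀ → j ℕ.< B → k ℕ.< C → i ℕ.+ (j ℕ.+ k) ≡ r → Mem (mulXYZ f (suc i) j k)) where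

      -- The coefficients of x^1, …, x^{A-1} in (x+y+z)f ≡ 0 say f_i ≡ -(y+z) f_{i+1}.
      slices : ∀ t i j k → t ℕ.+ i ≡ A₀ → j ℕ.< B → k ℕ.< C → i ℕ.+ (j ℕ.+ k) ≡ r →
        Mem (f i j k + - negMulYZ^ t (f A₀) j k)
      slices zero    i j k ≡.refl j<B k<C eq = resp (sym (-‿inverseʳ _)) 0∈
      slices (suc t) i j k t+i    j<B k<C eq = resp rearrange
        (+-clos (interior i j k i<A₀ j<B k<C eq) (neg-clos (diff (j ℕ.+ k) ≡.refl)))
        where
        i<A₀ : i ℕ.< A₀
        i<A₀ = ℕ.≤-trans (s≤s (ℕ.m≤n+m i t)) (ℕ.≤-reflexive t+i)
        F = mulYZ (f (suc i)) j k
        G = mulYZ (negMulYZ^ t (f A₀)) j k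
        diff : ∀ s → j ℕ.+ k ≡ s → Mem (F + - G)
        -- Here j = k = 0, where the next slice would have negative degree: both products have
        -- coefficient 0.
        diff zero    s≡ with ℕ.m+n≡0⇒m≡0 j s≡ | ℕ.m+n≡0⇒n≡0 j s≡
        ... | ≡.refl | ≡.refl = resp (sym (-‿inverseʳ _)) 0∈
        diff (suc s) s≡ = mulYZ-diff s
          (λ j′ k′ j′<B k′<C eq′ → slices t (suc i) j′ k′ (≡.trans (ℕ.+-suc t i) t+i) j′<B k′<C
            (≡.trans (≡.sym (ℕ.+-suc i (j′ ℕ.+ k′))) (≡.trans (≡.cong (i ℕ.+_) (≡.trans (≡.cong suc eq′) (≡.sym s≡))) eq)))
          j k j<B k<C s≡
        rearrange : (f i j k + F) + - (F + - G) ≈ f i j k + - - G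
        rearrange = begin
          (f i j k + F) + - (F + - G)     ≈⟨ +-congˡ (⁻¹-∙-comm F (- G)) ⟨
          (f i j k + F) + (- F + - - G)   ≈⟨ +-assoc _ _ _ ⟩
          f i j k + (F + (- F + - - G))   ≈⟨ +-congˡ (+-assoc F (- F) (- - G)) ⟨
          f i j k + (F + - F + - - G)     ≈⟨ +-congˡ (+-congʳ (-‿inverseʳ F)) ⟩
          f i j k + (0# + - - G)          ≈⟨ +-congˡ (+-identityˡ _) ⟩
          f i j k + - - G                 ∎

      -- The x⁰ coefficient of (x+y+z)f is (y+z)f₀, and `slices` gives f₀ ≡ (-(y+z))^A₀ f_A₀. One
      -- more factor -(y+z) makes the two terms cancel.
      bottom : ∀ j k → j ℕ.< B → k ℕ.< C → j ℕ.+ k ≡ suc r →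
        Mem (mulXYZ f 0 j k + negMulYZ^ (suc A₀) (f A₀) j k)
      bottom j k j<B k<C eq = resp (+-congʳ (sym (+-identityˡ _)))
        (mulYZ-diff r (λ j′ k′ → slices A₀ 0 j′ k′ (ℕ.+-identityʳ A₀)) j k j<B k<C eq)

      -- Each slice is congruent to a power of -(y+z) times the top slice, so it lies in the ideal
      -- once the top slice does.
      top-determines : ∀ D → A₀ ℕ.+ D ≡ r →
        (∀ j k → j ℕ.< B → k ℕ.< C → j ℕ.+ k ≡ D → Mem (f A₀ j k)) →
        ∀ i j k → i ℕ.≤ A₀ → j ℕ.< B → k ℕ.< C → i ℕ.+ (j ℕ.+ k) ≡ r → Mem (f i j k)
      top-determines D A₀+D≡r top i j k i≤A₀ j<B k<C eq = cancelʳ (slices t i j k t+i≡A₀ j<B k<C eq)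
        (neg-clos (negMulYZ^-clos D (f A₀) top t j k j<B k<C
          (ℕ.+-cancelˡ-≡ i _ _ (≡.trans eq (≡.trans (≡.sym A₀+D≡r) (≡.trans (≡.cong (ℕ._+ D)
            (≡.trans (≡.sym t+i≡A₀) (ℕ.+-comm t i))) (ℕ.+-assoc i t D)))))))
        where
        t = A₀ ℕ.∸ i
        t+i≡A₀ : t ℕ.+ i ≡ A₀
        t+i≡A₀ = ℕ.m∸n+n≡m i≤A₀

open import Data.Integer as ℤ using (ℤ; +_; -[1+_]; ∣_∣)
import Data.Integer.Divisibility as ℤᵤ
open import Data.Integer.Divisibility.Signed as ℤ using (_∣_; divides; ∣ᵤ⇒∣; ∣⇒∣ᵤ)
import Data.Integer.Properties as ℤ
open ≡ using (refl; sym; trans; cong; cong₂; subst)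

-- The monomial basis as a list without repetitions.

∈-concatMap-intro : ∀ {X Y : Set} (f : X → List Y) {x y xs} → x ∈ xs → y ∈ f x → y ∈ concatMap f xs
∈-concatMap-intro f {y = y} x∈xs y∈fx = ∈-concatMap⁺ f (Any.map (λ { refl → y∈fx }) x∈xs)

∈-concatMap-elim : ∀ {X Y : Set} (f : X → List Y) {y} xs → y ∈ concatMap f xs → ∃ λ x → x ∈ xs × y ∈ f x
∈-concatMap-elim f xs y∈ = find (∈-concatMap⁻ f y∈)

-- `key` recovers from a member of `f x` the `x` it came from, so the blocks for distinct `x` are
-- disjoint.
concatMap-unique : ∀ {X Y : Set} (f : X → List Y) (key : Y → X) {xs} →
  (∀ {x y} → y ∈ f x → key y ≡ x) → (∀ x → Unique (f x)) → Unique xs → Unique (concatMap f xs)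
concatMap-unique f key {xs} keyed uf ux = Unique.concat⁺
  (All.map⁺ (All.universal uf xs))
  (AllPairs.map⁺ (AllPairs.map (λ x≢y {v} v∈ → x≢y (trans (sym (keyed (proj₁ v∈))) (keyed (proj₂ v∈)))) ux))

lookup-injective : ∀ {X : Set} {xs : List X} → Unique xs → Injective _≡_ _≡_ (lookup xs)
lookup-injective (_ ∷ _)    {zero}  {zero}  _  = refl
lookup-injective (x∉xs ∷ _) {zero}  {suc j} eq = contradiction eq (All.lookup x∉xs (∈-lookup j))
lookup-injective (x∉xs ∷ _) {suc i} {zero}  eq = contradiction (sym eq) (All.lookup x∉xs (∈-lookup i))
lookup-injective (_ ∷ uxs)  {suc i} {suc j} eq = cong suc (lookup-injective uxs eq)

module _ (A B C r : ℕ) where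

  private
    col : ℕ → ℕ → List Mon
    col i j = map (λ k → (i , j , k)) (upTo C)
    slice : ℕ → List Mon
    slice i = concatMap (col i) (upTo B)

  ∈-monos⁺ : ∀ {i j k} → i ℕ.< A → j ℕ.< B → k ℕ.< C → i ℕ.+ (j ℕ.+ k) ≡ r → (i , j , k) ∈ monos A B C r
  ∈-monos⁺ {i} {j} {k} i<A j<B k<C eq = ∈-filter⁺ _
    (∈-concatMap-intro slice (∈-upTo⁺ i<A) (∈-concatMap-intro (col i) (∈-upTo⁺ j<B) (∈-map⁺ _ (∈-upTo⁺ k<C))))
    (trans (ℕ.+-assoc i j k) eq)

  ∈-monos⁻ : ∀ {i j k} → (i , j , k) ∈ monos A B C r → i ℕ.< A × j ℕ.< B × k ℕ.< C × i ℕ.+ (j ℕ.+ k) ≡ r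
  ∈-monos⁻ {i} {j} {k} t∈ with ∈-filter⁻ _ {xs = concatMap slice (upTo A)} t∈
  ... | t∈box , eq with ∈-concatMap-elim slice (upTo A) t∈box
  ... | i′ , i∈ , t∈slice with ∈-concatMap-elim (col i′) (upTo B) t∈slice
  ... | j′ , j∈ , t∈col with ∈-map⁻ _ t∈col
  ... | k′ , k∈ , refl = ∈-upTo⁻ i∈ , ∈-upTo⁻ j∈ , ∈-upTo⁻ k∈ , trans (sym (ℕ.+-assoc i j k)) eq

  monos-unique : Unique (monos A B C r)
  monos-unique = Unique.filter⁺ _ (concatMap-unique slice proj₁ slice-key
    (λ i → concatMap-unique (col i) (proj₁ ∘ proj₂) col-key
      (λ j → Unique.map⁺ (cong (proj₂ ∘ proj₂)) (Unique.upTo⁺ C)) (Unique.upTo⁺ B)) (Unique.upTo⁺ A))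
    where
    col-key : ∀ {i j t} → t ∈ col i j → proj₁ (proj₂ t) ≡ j
    col-key t∈ with ∈-map⁻ _ t∈
    ... | _ , _ , refl = refl
    slice-key : ∀ {i t} → t ∈ slice i → proj₁ t ≡ i
    slice-key {i} t∈ with ∈-concatMap-elim (col i) (upTo B) t∈
    ... | _ , _ , t∈col with ∈-map⁻ _ t∈col
    ... | _ , _ , refl = refl

  basis-injective : Injective _≡_ _≡_ (basis A B C r)
  basis-injective = lookup-injective monos-unique

  indexOf : ∀ {t} → t ∈ monos A B C r → ∃ λ b → basis A B C r b ≡ t
  indexOf t∈ = Any.index t∈ , sym (lookup-index t∈)

-- Sending a position in `xs` to a position of the same element in `ys` is injective, since `xs` has
-- no repetitions.
subset-length : ∀ {X : Set} {xs ys : List X} → Unique xs → (∀ {t} → t ∈ xs → t ∈ ys) → length xs ℕ.≤ length ys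
subset-length {xs = xs} {ys} uxs sub = injective⇒≤ {f = λ i → Any.index (sub (∈-lookup i))} λ {i} {j} eq →
  lookup-injective uxs (trans (lookup-index (sub (∈-lookup i)))
    (trans (cong (lookup ys) eq) (sym (lookup-index (sub (∈-lookup j))))))

-- Numerical bounds and monomial counts in the given degree range.

module Setup (A₀ B C r D : ℕ) (A₀+D≡r : A₀ ℕ.+ D ≡ r) (C≤B : C ℕ.≤ B) (B≤A : B ℕ.≤ suc A₀)
             (2r+4≤A+B+C : 2 ℕ.* r ℕ.+ 4 ℕ.≤ suc A₀ ℕ.+ B ℕ.+ C) where

  -- Here A₀ = A-1, and D = r-A₀ is the degree of the top slice g. The hypothesis 2r+4 ≤ A+B+C is r
  -- ≤ ⌊(e-1)/2⌋ written without division. `U` is m × n and `M` is m′ × n′.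
  A n m n′ m′ : ℕ
  A  = suc A₀
  n  = dimR A B C r
  m  = dimR A B C (suc r)
  n′ = r ℕ.+ 2 ℕ.∸ A
  m′ = B ℕ.+ C ℕ.∸ (r ℕ.+ 2)

  n′≡1+D : n′ ≡ suc D
  n′≡1+D = trans (cong (ℕ._∸ A) (trans (cong (ℕ._+ 2) (sym A₀+D≡r)) eq)) (ℕ.m+n∸m≡n A (suc D))
    where
    eq : A₀ ℕ.+ D ℕ.+ 2 ≡ A ℕ.+ suc D
    eq = solve 2 (λ a d → a :+ d :+ con 2 := con 1 :+ a :+ (con 1 :+ d)) refl A₀ D

  2D+2≤C : D ℕ.+ (2 ℕ.+ D) ℕ.≤ C
  2D+2≤C = ℕ.+-cancelˡ-≤ (A₀ ℕ.+ (2 ℕ.+ A₀)) _ _ (begin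
    A₀ ℕ.+ (2 ℕ.+ A₀) ℕ.+ (D ℕ.+ (2 ℕ.+ D)) ≡⟨ solve 2 (λ a d → a :+ (con 2 :+ a) :+ (d :+ (con 2 :+ d)) := con 2 :* (a :+ d) :+ con 4) refl A₀ D ⟩
    2 ℕ.* (A₀ ℕ.+ D) ℕ.+ 4                 ≡⟨ cong (λ x → 2 ℕ.* x ℕ.+ 4) A₀+D≡r ⟩
    2 ℕ.* r ℕ.+ 4                          ≤⟨ 2r+4≤A+B+C ⟩
    A ℕ.+ B ℕ.+ C                          ≤⟨ ℕ.+-monoˡ-≤ C (ℕ.+-monoʳ-≤ A B≤A) ⟩
    A ℕ.+ A ℕ.+ C                          ≡⟨ cong (ℕ._+ C) (solve 1 (λ a → (con 1 :+ a) :+ (con 1 :+ a) := a :+ (con 2 :+ a)) refl A₀) ⟩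
    A₀ ℕ.+ (2 ℕ.+ A₀) ℕ.+ C                ∎)
    where open ℕ.≤-Reasoning

  -- Hence every monomial of degree D in y and z survives the truncation, and g has exactly D+1 = n′
  -- coefficients.
  D<C : D ℕ.< C
  D<C = ℕ.≤-trans (s≤s (ℕ.m≤m+n D (suc D))) (ℕ.≤-trans (ℕ.≤-reflexive (sym (ℕ.+-suc D (suc D)))) 2D+2≤C)

  -- This is the degree bound with A cancelled. It makes `M` at least as tall as wide and keeps the
  -- z-exponents of `bottomPt` below C.
  r+2+D<B+C : r ℕ.+ 2 ℕ.+ D ℕ.< B ℕ.+ C
  r+2+D<B+C = ℕ.+-cancelˡ-≤ A _ _ (begin
    A ℕ.+ suc (r ℕ.+ 2 ℕ.+ D)             ≡⟨ cong (λ x → A ℕ.+ suc (x ℕ.+ 2 ℕ.+ D)) (sym A₀+D≡r) ⟩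
    A ℕ.+ suc (A₀ ℕ.+ D ℕ.+ 2 ℕ.+ D)      ≡⟨ solve 2 (λ a d → (con 1 :+ a) :+ (con 1 :+ (a :+ d :+ con 2 :+ d)) := con 2 :* (a :+ d) :+ con 4) refl A₀ D ⟩
    2 ℕ.* (A₀ ℕ.+ D) ℕ.+ 4                ≡⟨ cong (λ x → 2 ℕ.* x ℕ.+ 4) A₀+D≡r ⟩
    2 ℕ.* r ℕ.+ 4                         ≤⟨ 2r+4≤A+B+C ⟩
    A ℕ.+ B ℕ.+ C                         ≡⟨ ℕ.+-assoc A B C ⟩
    A ℕ.+ (B ℕ.+ C)                       ∎)
    where open ℕ.≤-Reasoning

  n′≤m′ : n′ ℕ.≤ m′
  n′≤m′ = subst (ℕ._≤ m′) (sym n′≡1+D) (ℕ.m+n≤o⇒m≤o∸n (suc D)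
    (ℕ.≤-trans (ℕ.≤-reflexive (cong suc (ℕ.+-comm D (r ℕ.+ 2)))) r+2+D<B+C))

  A≤r+1 : A ℕ.≤ suc r
  A≤r+1 = s≤s (ℕ.≤-trans (ℕ.m≤m+n A₀ D) (ℕ.≤-reflexive A₀+D≡r))

  B≤r+2 : B ℕ.≤ r ℕ.+ 2
  B≤r+2 = ℕ.≤-trans (ℕ.≤-trans B≤A A≤r+1) (ℕ.≤-trans (ℕ.n≤1+n _) (ℕ.≤-reflexive (ℕ.+-comm 2 r)))

  -- `topPt c` is the monomial of column `c` of `M`, and `bottomPt c` the degree r+1 monomial of row
  -- `c`; both are ordered by the z-exponent.
  topPt bottomPt : ℕ → Mon
  topPt c    = A₀ , D ℕ.∸ c , c
  bottomPt c = 0 , B ℕ.∸ suc c , r ℕ.+ 2 ℕ.∸ B ℕ.+ c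

  raise : Mon → Mon
  raise (i , j , k) = suc i , j , k

  -- The monomials t of degree r with xt still nonzero. The coefficients of (x+y+z)f at these xt
  -- give the relations between consecutive slices.
  interiorPts : List Mon
  interiorPts = filter (λ t → proj₁ t ℕ.<? A₀) (monos A B C r)

  q : ℕ
  q = length interiorPts

  <n′⇒≤D : ∀ {c} → c ℕ.< n′ → c ℕ.≤ D
  <n′⇒≤D {c} c<n′ = ℕ.≤-pred (subst (c ℕ.<_) n′≡1+D c<n′)

  topPt∈ : ∀ {c} → c ℕ.< n′ → topPt c ∈ monos A B C r
  topPt∈ {c} c<n′ = ∈-monos⁺ A B C r ℕ.≤-refl
    (ℕ.≤-trans (s≤s (ℕ.m∸n≤m D c)) (ℕ.≤-trans D<C C≤B)) (ℕ.≤-trans (s≤s c≤D) D<C)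
    (trans (cong (A₀ ℕ.+_) (ℕ.m∸n+n≡m c≤D)) A₀+D≡r)
    where c≤D = <n′⇒≤D c<n′

  bottomPt∈ : ∀ {c} → c ℕ.< n′ → bottomPt c ∈ monos A B C (suc r)
  bottomPt∈ {c} c<n′ = ∈-monos⁺ A B C (suc r) (s≤s z≤n) (ℕ.∸-monoʳ-< (s≤s z≤n) c<B) k<C
    (ℕ.+-cancelʳ-≡ (suc c) _ _ (begin
      j ℕ.+ (k₀ ℕ.+ c) ℕ.+ suc c  ≡⟨ solve 3 (λ j k c → j :+ (k :+ c) :+ (con 1 :+ c) := (j :+ (con 1 :+ c)) :+ k :+ c) refl j k₀ c ⟩
      (j ℕ.+ suc c) ℕ.+ k₀ ℕ.+ c  ≡⟨ cong (λ x → x ℕ.+ k₀ ℕ.+ c) (ℕ.m∸n+n≡m c<B) ⟩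
      B ℕ.+ k₀ ℕ.+ c              ≡⟨ cong (ℕ._+ c) (ℕ.m+[n∸m]≡n B≤r+2) ⟩
      r ℕ.+ 2 ℕ.+ c               ≡⟨ solve 2 (λ r c → r :+ con 2 :+ c := con 1 :+ r :+ (con 1 :+ c)) refl r c ⟩
      suc r ℕ.+ suc c             ∎))
    where
    open ≡.≡-Reasoning
    j = B ℕ.∸ suc c
    k₀ = r ℕ.+ 2 ℕ.∸ B
    c≤D = <n′⇒≤D c<n′
    c<B : c ℕ.< B
    c<B = ℕ.≤-trans (s≤s c≤D) (ℕ.≤-trans D<C C≤B)
    k<C : k₀ ℕ.+ c ℕ.< C
    k<C = ℕ.+-cancelˡ-< B _ _ (ℕ.≤-trans (s≤s (ℕ.≤-trans
      (ℕ.≤-reflexive (trans (sym (ℕ.+-assoc B k₀ c)) (cong (ℕ._+ c) (ℕ.m+[n∸m]≡n B≤r+2))))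
      (ℕ.+-monoʳ-≤ (r ℕ.+ 2) c≤D))) r+2+D<B+C)

  interior⁻ : ∀ {t} → t ∈ interiorPts → t ∈ monos A B C r × proj₁ t ℕ.< A₀
  interior⁻ = ∈-filter⁻ (λ t → proj₁ t ℕ.<? A₀) {xs = monos A B C r}

  raise∈ : ∀ {t} → t ∈ interiorPts → raise t ∈ monos A B C (suc r)
  raise∈ t∈ with interior⁻ t∈
  ... | t∈monos , i<A₀ with ∈-monos⁻ A B C r t∈monos
  ... | _ , j<B , k<C , eq = ∈-monos⁺ A B C (suc r) (s≤s i<A₀) j<B k<C (cong suc eq)

  private
    length-with : ∀ (xs : List Mon) (f : ℕ → Mon) → length (xs ++ map f (upTo n′)) ≡ length xs ℕ.+ n′
    length-with xs f = trans (length-++ xs) (cong (length xs ℕ.+_) (trans (length-map f (upTo n′)) (length-upTo n′)))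

  -- A monomial of degree r has x-exponent below A₀, or it has x-exponent A₀ and is fixed by its
  -- z-exponent, which is at most D.
  n≡q+n′ : n ≡ q ℕ.+ n′
  n≡q+n′ = ℕ.≤-antisym
    (ℕ.≤-trans (subset-length {ys = interiorPts ++ map topPt (upTo n′)} (monos-unique A B C r) covers)
      (ℕ.≤-reflexive (length-with interiorPts topPt)))
    (ℕ.≤-trans (ℕ.≤-reflexive (sym (length-with interiorPts topPt))) (subset-length uniq sub))
    where
    covers : ∀ {t} → t ∈ monos A B C r → t ∈ interiorPts ++ map topPt (upTo n′)
    covers {i , j , k} t∈ with i ℕ.<? A₀
    ... | yes i<A₀ = ∈-++⁺ˡ (∈-filter⁺ _ t∈ i<A₀)
    ... | no  i≮A₀ with ∈-monos⁻ A B C r t∈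
    ... | i<A , _ , _ , eq with ℕ.≤-antisym (ℕ.≤-pred i<A) (ℕ.≮⇒≥ i≮A₀)
    ... | refl = ∈-++⁺ʳ interiorPts (subst (_∈ map topPt (upTo n′)) (cong (λ x → A₀ , x , k) j≡)
                   (∈-map⁺ topPt (∈-upTo⁺ k<n′)))
      where
      j+k≡D : j ℕ.+ k ≡ D
      j+k≡D = ℕ.+-cancelˡ-≡ A₀ _ _ (trans eq (sym A₀+D≡r))
      j≡ : D ℕ.∸ k ≡ j
      j≡ = trans (cong (ℕ._∸ k) (sym j+k≡D)) (ℕ.m+n∸n≡m j k)
      k<n′ : k ℕ.< n′
      k<n′ = subst (k ℕ.<_) (sym n′≡1+D) (s≤s (ℕ.≤-trans (ℕ.m≤n+m k j) (ℕ.≤-reflexive j+k≡D)))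
    uniq : Unique (interiorPts ++ map topPt (upTo n′))
    uniq = Unique.++⁺ (Unique.filter⁺ _ (monos-unique A B C r))
      (Unique.map⁺ (cong (proj₂ ∘ proj₂)) (Unique.upTo⁺ n′)) disjoint
      where
      disjoint : ∀ {t} → ¬ (t ∈ interiorPts × t ∈ map topPt (upTo n′))
      disjoint (t∈ , t∈′) with ∈-map⁻ topPt t∈′
      ... | _ , _ , refl = ℕ.<-irrefl refl (proj₂ (interior⁻ t∈))
    sub : ∀ {t} → t ∈ interiorPts ++ map topPt (upTo n′) → t ∈ monos A B C r
    sub t∈ with ∈-++⁻ interiorPts t∈
    ... | inj₁ t∈i = proj₁ (interior⁻ t∈i)
    ... | inj₂ t∈t with ∈-map⁻ topPt t∈t
    ... | c , c∈ , refl = topPt∈ (∈-upTo⁻ c∈)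

  -- An injection of the degree r basis into the degree r+1 basis: interior monomials are multiplied
  -- by x, and top monomials go to monomials free of x. A Smith list of `U` thus has n entries.
  n≤m : n ℕ.≤ m
  n≤m = ℕ.≤-trans (ℕ.≤-reflexive (trans n≡q+n′ (trans (cong (ℕ._+ n′) (sym (length-map raise interiorPts)))
      (sym (length-with (map raise interiorPts) bottomPt))))) (subset-length uniq sub)
    where
    uniq : Unique (map raise interiorPts ++ map bottomPt (upTo n′))
    uniq = Unique.++⁺ (Unique.map⁺ (λ { refl → refl }) (Unique.filter⁺ _ (monos-unique A B C r)))
      (Unique.map⁺ (λ eq → ℕ.+-cancelˡ-≡ (r ℕ.+ 2 ℕ.∸ B) _ _ (cong (proj₂ ∘ proj₂) eq)) (Unique.upTo⁺ n′)) disjoint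
      where
      disjoint : ∀ {t} → ¬ (t ∈ map raise interiorPts × t ∈ map bottomPt (upTo n′))
      disjoint (t∈ , t∈′) with ∈-map⁻ bottomPt t∈′ | ∈-map⁻ raise t∈
      ... | _ , _ , refl | _ , _ , ()
    sub : ∀ {t} → t ∈ map raise interiorPts ++ map bottomPt (upTo n′) → t ∈ monos A B C (suc r)
    sub t∈ with ∈-++⁻ (map raise interiorPts) t∈
    ... | inj₁ t∈i with ∈-map⁻ raise t∈i
    ...   | _ , s∈ , refl = raise∈ s∈
    sub t∈ | inj₂ t∈b with ∈-map⁻ bottomPt t∈b
    ...   | _ , c∈ , refl = bottomPt∈ (∈-upTo⁻ c∈)

  -- The rows of `U` as conditions on a coordinate vector.

  module Over {c ℓ} (R : CommutativeRing c ℓ) where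
    open CommutativeRing R using (Carrier; 0#; 1#)
    open LinearAlgebra R
    open Multiplication R

    UR : Matrix Carrier m n
    UR = UMatOver 0# 1# A B C r

    -- The row of `U` addressed by its target monomial instead of by a position in the basis.
    stepRow : Mon → Fin n → Carrier
    stepRow t b = ind (mulStep t (basis A B C r b))

    topRow : ℕ → Fin n → Carrier
    topRow c = coeff (basis A B C r) (topPt c)

    ser : (Fin n → Carrier) → ℕ → ℕ → ℕ → Carrier
    ser = series (basis A B C r)

    module _ {p} (I : Ideal p) (w : Fin n → Carrier) where
      open Ideal I

      image-mem : (∀ a → Mem (UR a ⋆ w)) → ∀ {t} → t ∈ monos A B C (suc r) → Mem (stepRow t ⋆ w)
      image-mem h t∈ with indexOf A B C (suc r) t∈
      ... | a , refl = h a

      interior-mem : (∀ {t} → t ∈ interiorPts → Mem (stepRow (raise t) ⋆ w)) →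
        ∀ i j k → i ℕ.< A₀ → j ℕ.< B → k ℕ.< C → i ℕ.+ (j ℕ.+ k) ≡ r → Mem (mulXYZ (ser w) (suc i) j k)
      interior-mem h i j k i<A₀ j<B k<C eq = resp (mulStep-⋆ (basis A B C r) w (suc i) j k)
        (h (∈-filter⁺ _ (∈-monos⁺ A B C r (ℕ.m<n⇒m<1+n i<A₀) j<B k<C eq) i<A₀))

      -- Injectivity modulo the ideal on vectors with vanishing top slice; every later use of the
      -- slice relations to recover `w` passes through here.
      determine : (∀ a → Mem (UR a ⋆ w)) → (∀ c → c ℕ.< n′ → Mem (topRow c ⋆ w)) → ∀ b → Mem (w b)
      determine h top b with ∈-monos⁻ A B C r (∈-lookup {xs = monos A B C r} b)
      ... | i<A , j<B , k<C , eq = resp (series-pts (basis A B C r) w (basis-injective A B C r) b)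
        (top-determines I B C A₀ r (ser w) (interior-mem (image-mem h ∘ raise∈)) D A₀+D≡r
          (λ j k _ _ j+k≡D → subst (λ x → Mem (ser w A₀ x k))
             (trans (cong (ℕ._∸ k) (sym j+k≡D)) (ℕ.m+n∸n≡m j k))
             (top k (subst (k ℕ.<_) (sym n′≡1+D) (s≤s (ℕ.≤-trans (ℕ.m≤n+m k j) (ℕ.≤-reflexive j+k≡D))))))
          _ _ _ (ℕ.≤-pred i<A) j<B k<C eq)

-- Divisibility and primitive vectors over ℤ.

open LinearAlgebra ℤ.+-*-commutativeRing
open Multiplication ℤ.+-*-commutativeRing

multiples : ℤ → Ideal _
multiples d = record
  { Mem    = d ∣_
  ; resp   = λ { refl d∣x → d∣x }
  ; 0∈     = divides (+ 0) refl
  ; +-clos = ℤ.∣m∣n⇒∣m+n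
  ; *-clos = ℤ.∣n⇒∣m*n
  }

gcdVec : ∀ {n} → (Fin n → ℤ) → ℕ
gcdVec {zero}  w = 0
gcdVec {suc n} w = gcd ∣ w zero ∣ (gcdVec (w ∘ suc))

gcdVec-∣ : ∀ {n} (w : Fin n → ℤ) i → gcdVec w ℕ.∣ ∣ w i ∣
gcdVec-∣ w zero    = gcd[m,n]∣m ∣ w zero ∣ (gcdVec (w ∘ suc))
gcdVec-∣ w (suc i) = ℕ.∣-trans (gcd[m,n]∣n ∣ w zero ∣ (gcdVec (w ∘ suc))) (gcdVec-∣ (w ∘ suc) i)

gcdVec-greatest : ∀ {n} (w : Fin n → ℤ) {m} c → (∀ i → m ℕ.∣ c ℕ.* ∣ w i ∣) → m ℕ.∣ c ℕ.* gcdVec w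
gcdVec-greatest {zero}  w {m} c h = subst (m ℕ.∣_) (sym (ℕ.*-zeroʳ c)) (m ℕ.∣0)
gcdVec-greatest {suc n} w {m} c h = subst (m ℕ.∣_) (sym (c*gcd[m,n]≡gcd[cm,cn] c ∣ w zero ∣ (gcdVec (w ∘ suc))))
  (gcd-greatest (h zero) (gcdVec-greatest (w ∘ suc) c (h ∘ suc)))

-- Coordinates of gcd 1, in the form needed later: a divisor of all of `c w` divides `c`.
Primitive : ∀ {n} → (Fin n → ℤ) → Set
Primitive w = ∀ {d} c → (∀ b → d ∣ c ℤ.* w b) → d ∣ c

ℤ-noZeroDivisors : ∀ {x y} → x ≢ + 0 → y ≢ + 0 → x ℤ.* y ≢ + 0
ℤ-noZeroDivisors {x} x≢0 y≢0 xy≡0 with ℤ.i*j≡0⇒i≡0∨j≡0 x xy≡0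
... | inj₁ x≡0 = x≢0 x≡0
... | inj₂ y≡0 = y≢0 y≡0

-- Division by the gcd of the coordinates, which is nonzero and can therefore be cancelled from
-- every linear condition.
primitivePart : ∀ {n} (w : Fin n → ℤ) {b} → w b ≢ + 0 →
  Σ (Fin n → ℤ) λ v → Primitive v × (∀ u → u ⋆ w ≡ + 0 → u ⋆ v ≡ + 0)
primitivePart w {b} wb≢0 = v , v-primitive , v-kernel
  where
  g = gcdVec w

  g≢0 : g ≢ 0
  g≢0 g≡0 = wb≢0 (ℤ.∣i∣≡0⇒i≡0 (ℕ.0∣⇒≡0 (subst (ℕ._∣ ∣ w b ∣) g≡0 (gcdVec-∣ w b))))

  g∣w : ∀ i → + g ∣ w i
  g∣w i = ∣ᵤ⇒∣ (gcdVec-∣ w i)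

  v : _ → ℤ
  v i = _∣_.quotient (g∣w i)

  w≡gv : ∀ i → w i ≡ + g ℤ.* v i
  w≡gv i = trans (_∣_.equality (g∣w i)) (ℤ.*-comm (v i) (+ g))

  v-kernel : ∀ u → u ⋆ w ≡ + 0 → u ⋆ v ≡ + 0
  v-kernel u u⋆w≡0 with ℤ.i*j≡0⇒i≡0∨j≡0 (+ g)
      (trans (sym (trans (∑-cong (λ i → cong (u i ℤ.*_) (w≡gv i))) (⋆-scaleʳ u (+ g) v))) u⋆w≡0)
  ... | inj₁ g≡0 = contradiction (ℤ.+-injective g≡0) g≢0
  ... | inj₂ eq  = eq

  v-primitive : Primitive v
  -- Multiplying by g turns the hypothesis into |d|g dividing every |c||wᵢ|, hence |c|g; then g
  -- cancels.
  v-primitive {d} c d∣cv = ∣ᵤ⇒∣ (ℕ.*-cancelʳ-∣ g {{ℕ.≢-nonZero g≢0}}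
    (gcdVec-greatest w ∣ c ∣ λ i → subst (∣ d ∣ ℕ.* g ℕ.∣_) (∣cv∣g i) (ℕ.*-monoˡ-∣ g (∣⇒∣ᵤ (d∣cv i)))))
    where
    open ≡.≡-Reasoning
    ∣cv∣g : ∀ i → ∣ c ℤ.* v i ∣ ℕ.* g ≡ ∣ c ∣ ℕ.* ∣ w i ∣
    ∣cv∣g i = begin
      ∣ c ℤ.* v i ∣ ℕ.* g           ≡⟨ cong (ℕ._* g) (ℤ.∣i*j∣≡∣i∣*∣j∣ c (v i)) ⟩
      ∣ c ∣ ℕ.* ∣ v i ∣ ℕ.* g       ≡⟨ ℕ.*-assoc ∣ c ∣ ∣ v i ∣ g ⟩
      ∣ c ∣ ℕ.* (∣ v i ∣ ℕ.* g)     ≡⟨ cong (∣ c ∣ ℕ.*_) (ℤ.∣i*j∣≡∣i∣*∣j∣ (v i) (+ g)) ⟨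
      ∣ c ∣ ℕ.* ∣ v i ℤ.* + g ∣     ≡⟨ cong (λ x → ∣ c ∣ ℕ.* ∣ x ∣) (_∣_.equality (g∣w i)) ⟨
      ∣ c ∣ ℕ.* ∣ w i ∣             ∎

PrimitiveKernel : ∀ {n} → List (Fin n → ℤ) → Set
PrimitiveKernel {n} rows = Σ (Fin n → ℤ) λ w → Primitive w × All (λ u → u ⋆ w ≡ + 0) rows

¬¬-primitiveKernel : ∀ {n} (rows : List (Fin n → ℤ)) → length rows ℕ.< n → ¬ ¬ PrimitiveKernel rows
¬¬-primitiveKernel rows lt ¬ker = Kernel.¬¬-kernel (λ ()) ℤ-noZeroDivisors rows lt
  λ { (w , (b , wb≢0) , rows⋆w≡0) → let (v , v-primitive , v-kernel) = primitivePart w wb≢0 in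
      ¬ker (v , v-primitive , All.map (λ {u} → v-kernel u) rows⋆w≡0) }

-- Smith normal forms through divisibility, and their non-unit entries.

idMat-⋆ : ∀ {n} (a : Fin n) w → idMat a ⋆ w ≡ w a
idMat-⋆ a w = trans (∑-single a off) on
  where
  off : ∀ j → j ≢ a → idMat a j ℤ.* w j ≡ + 0
  off j j≢a with toℕ a ℕ.≡ᵇ toℕ j in eq
  ... | false = refl
  ... | true  = contradiction (sym (toℕ-injective (ℕ.≡ᵇ⇒≡ _ _ (subst T (sym eq) _)))) j≢a
  on : idMat a a ℤ.* w a ≡ w a
  on with toℕ a ℕ.≡ᵇ toℕ a in eq
  ... | true  = ℤ.*-identityˡ (w a)
  ... | false = contradiction (ℕ.≡⇒≡ᵇ (toℕ a) _ refl) (subst (λ x → ¬ T x) (sym eq) (λ ()))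

diagMat-diag : ∀ {m n} ds {a : Fin m} {b : Fin n} → toℕ a ≡ toℕ b → diagMat ds a b ≡ nth ds (toℕ b)
diagMat-diag ds {a} {b} a≡b with toℕ a ℕ.≡ᵇ toℕ b in eq
... | true  = cong (nth ds) a≡b
... | false = contradiction (ℕ.≡⇒≡ᵇ (toℕ a) _ a≡b) (subst (λ x → ¬ T x) (sym eq) (λ ()))

diagMat-off : ∀ {m n} ds {a : Fin m} {b : Fin n} → toℕ a ≢ toℕ b → diagMat ds a b ≡ + 0
diagMat-off ds {a} {b} a≢b with toℕ a ℕ.≡ᵇ toℕ b in eq
... | false = refl
... | true  = contradiction (ℕ.≡ᵇ⇒≡ _ _ (subst T (sym eq) _)) a≢b

-- Only divisibility of the values of W matters for comparing Smith forms, so the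
-- transformation of the target is not recorded.
record Diagonalisation {m n} (W : Matrix ℤ m n) (ds : List ℤ) : Set where
  field
    coords       : Matrix ℤ n n
    image⇒coords : ∀ d w → (∀ a → d ∣ W a ⋆ w) → ∀ b → d ∣ nth ds (toℕ b) ℤ.* (coords b ⋆ w)
    coords⇒image : ∀ d w → (∀ b → d ∣ nth ds (toℕ b) ℤ.* (coords b ⋆ w)) → ∀ a → d ∣ W a ⋆ w
    reconstruct  : ∀ d e w → (∀ b → d ∣ e ℤ.* (coords b ⋆ w)) → ∀ b → d ∣ e ℤ.* w b

-- The Smith coordinates of w are those of Q⁻¹w, because PWw = diag(ds) Q⁻¹w. Since n ≤ m, each
-- coordinate b has its own row of the diagonal matrix.
diagonalise : ∀ {m n} {W : Matrix ℤ m n} {ds} → n ℕ.≤ m → IsSNF W ds → Diagonalisation W ds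
diagonalise {m} {n} {W} {ds} n≤m (_ , _ , P , Q , (P⁻¹ , _ , P⁻¹P) , (Q⁻¹ , QQ⁻¹ , _) , PWQ) = record
  { coords       = Q⁻¹
  ; image⇒coords = λ d w h b → subst (d ∣_) (diag-⋆ w b) (subst (d ∣_) (PW w (inject≤ b n≤m))
      (Ideal.∑-clos (multiples d) (λ x → ℤ.∣n⇒∣m*n (P (inject≤ b n≤m) x) (h x))))
  ; coords⇒image = λ d w h a → subst (d ∣_) (P⁻¹PW w a)
      (Ideal.∑-clos (multiples d) (λ x → ℤ.∣n⇒∣m*n (P⁻¹ a x) (subst (d ∣_) (sym (PW w x)) (diag-∣ d w h x))))
  ; reconstruct  = λ d e w h b → subst (d ∣_) (trans (⋆-scaleʳ (Q b) e (λ x → Q⁻¹ x ⋆ w)) (cong (e ℤ.*_) (QQ⁻¹w w b)))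
      (Ideal.∑-clos (multiples d) (λ x → ℤ.∣n⇒∣m*n (Q b x) (h x)))
  }
  where
  open ≡.≡-Reasoning
  QQ⁻¹w : ∀ w b → Q b ⋆ (λ x → Q⁻¹ x ⋆ w) ≡ w b
  QQ⁻¹w w b = begin
    Q b ⋆ (λ x → Q⁻¹ x ⋆ w)  ≡⟨ ⋆-assoc (Q b) Q⁻¹ w ⟨
    (Q · Q⁻¹) b ⋆ w          ≡⟨ ∑-cong (λ j → cong (ℤ._* w j) (QQ⁻¹ b j)) ⟩
    idMat b ⋆ w              ≡⟨ idMat-⋆ b w ⟩
    w b                      ∎
  P⁻¹PW : ∀ w a → P⁻¹ a ⋆ (λ x → P x ⋆ (λ y → W y ⋆ w)) ≡ W a ⋆ w
  P⁻¹PW w a = begin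
    P⁻¹ a ⋆ (λ x → P x ⋆ (λ y → W y ⋆ w)) ≡⟨ ⋆-assoc (P⁻¹ a) P (λ y → W y ⋆ w) ⟨
    (P⁻¹ · P) a ⋆ (λ y → W y ⋆ w)         ≡⟨ ∑-cong (λ j → cong (ℤ._* (W j ⋆ w)) (P⁻¹P a j)) ⟩
    idMat a ⋆ (λ y → W y ⋆ w)             ≡⟨ idMat-⋆ a _ ⟩
    W a ⋆ w                               ∎
  PW : ∀ w a → P a ⋆ (λ y → W y ⋆ w) ≡ diagMat ds a ⋆ (λ x → Q⁻¹ x ⋆ w)
  PW w a = begin
    P a ⋆ (λ y → W y ⋆ w)                              ≡⟨ ⋆-assoc (P a) W w ⟨
    (P · W) a ⋆ w                                      ≡⟨ ∑-cong (λ j → cong ((P · W) a j ℤ.*_) (QQ⁻¹w w j)) ⟨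
    (P · W) a ⋆ (λ j → Q j ⋆ (λ x → Q⁻¹ x ⋆ w))        ≡⟨ ⋆-assoc ((P · W) a) Q _ ⟨
    ((P · W) · Q) a ⋆ (λ x → Q⁻¹ x ⋆ w)                ≡⟨ ∑-cong (λ j → cong (ℤ._* (Q⁻¹ j ⋆ w)) (PWQ a j)) ⟩
    diagMat ds a ⋆ (λ x → Q⁻¹ x ⋆ w)                   ∎
  diag-⋆ : ∀ w b → diagMat ds (inject≤ b n≤m) ⋆ (λ x → Q⁻¹ x ⋆ w) ≡ nth ds (toℕ b) ℤ.* (Q⁻¹ b ⋆ w)
  diag-⋆ w b = trans
    (∑-single b λ j j≢b → cong (ℤ._* (Q⁻¹ j ⋆ w))
      (diagMat-off ds {inject≤ b n≤m} {j} λ eq → j≢b (sym (toℕ-injective (trans (sym (toℕ-inject≤ b n≤m)) eq)))))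
    (cong (ℤ._* (Q⁻¹ b ⋆ w)) (diagMat-diag ds {inject≤ b n≤m} {b} (toℕ-inject≤ b n≤m)))
  diag-∣ : ∀ d w → (∀ b → d ∣ nth ds (toℕ b) ℤ.* (Q⁻¹ b ⋆ w)) → ∀ (a : Fin m) → d ∣ diagMat ds a ⋆ (λ x → Q⁻¹ x ⋆ w)
  diag-∣ d w h a = Ideal.∑-clos (multiples d) λ j → term j (toℕ a ℕ.≟ toℕ j)
    where
    term : ∀ j → Dec (toℕ a ≡ toℕ j) → d ∣ diagMat ds a j ℤ.* (Q⁻¹ j ⋆ w)
    term j (yes a≡j) = subst (λ x → d ∣ x ℤ.* (Q⁻¹ j ⋆ w)) (sym (diagMat-diag ds {a} {j} a≡j)) (h j)
    term j (no a≢j)  = subst (λ x → d ∣ x ℤ.* (Q⁻¹ j ⋆ w)) (sym (diagMat-off ds {a} {j} a≢j)) (divides (+ 0) refl)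

-- Past the end of the list `nth` takes the value 0, a multiple of everything, so the divisibility
-- chain continues there.
nth-chain : ∀ {ds} → Linked ℤᵤ._∣_ ds → ∀ {i j} → i ℕ.≤ j → nth ds i ∣ nth ds j
nth-chain {[]}         _   i≤j = ℤ.∣-refl
nth-chain {d ∷ []}     _   {zero}  {zero}  _ = ℤ.∣-refl
nth-chain {d ∷ []}     _   {i}     {suc j} _ = divides (+ 0) refl
nth-chain {d ∷ _ ∷ _}  _   {zero}  {zero}  _ = ℤ.∣-refl
nth-chain {d ∷ _ ∷ _}  (d∣e ∷ l) {zero}  {suc j} _ = ℤ.∣-trans (∣ᵤ⇒∣ d∣e) (nth-chain l {zero} {j} z≤n)
nth-chain {d ∷ _ ∷ _}  (_ ∷ l)   {suc i} {suc j} (s≤s i≤j) = nth-chain l i≤j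

nonUnits-unit : ∀ d ds → ∣ d ∣ ≡ 1 → nonUnits (d ∷ ds) ≡ nonUnits ds
nonUnits-unit d ds d≡1 = cong (map ∣_∣) (filter-reject (λ a → ¬? (∣ a ∣ ℕ.≟ 1)) {x = d} {xs = ds} (λ d≢1 → d≢1 d≡1))

nonUnits-nonUnit : ∀ d ds → ∣ d ∣ ≢ 1 → nonUnits (d ∷ ds) ≡ ∣ d ∣ ∷ nonUnits ds
nonUnits-nonUnit d ds d≢1 = cong (map ∣_∣) (filter-accept (λ a → ¬? (∣ a ∣ ℕ.≟ 1)) {x = d} {xs = ds} d≢1)

nonUnits-≡ : ∀ q ds ds′ → length ds ≡ q ℕ.+ length ds′ →
  (∀ k → k ℕ.< q → ∣ nth ds k ∣ ≡ 1) →
  (∀ k → k ℕ.< length ds′ → ∣ nth ds (q ℕ.+ k) ∣ ≡ ∣ nth ds′ k ∣) →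
  nonUnits ds ≡ nonUnits ds′
nonUnits-≡ zero [] [] len unit same = refl
nonUnits-≡ zero (d ∷ ds) (d′ ∷ ds′) len unit same with ∣ d ∣ ℕ.≟ 1
  | nonUnits-≡ zero ds ds′ (ℕ.suc-injective len) (λ _ ()) (λ k lt → same (suc k) (s≤s lt))
... | yes d≡1 | ih = trans (nonUnits-unit d ds d≡1)
  (trans ih (sym (nonUnits-unit d′ ds′ (trans (sym (same zero (s≤s z≤n))) d≡1))))
... | no  d≢1 | ih = trans (nonUnits-nonUnit d ds d≢1) (trans (cong₂ _∷_ (same zero (s≤s z≤n)) ih)
  (sym (nonUnits-nonUnit d′ ds′ (λ d′≡1 → d≢1 (trans (same zero (s≤s z≤n)) d′≡1)))))
nonUnits-≡ (suc q) (d ∷ ds) ds′ len unit same = trans (nonUnits-unit d ds (unit zero (s≤s z≤n)))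
  (nonUnits-≡ q ds ds′ (ℕ.suc-injective len) (λ k lt → unit (suc k) (s≤s lt)) same)

nonUnits-length : ∀ q p ds → length ds ≡ q ℕ.+ p → (∀ k → k ℕ.< q → ∣ nth ds k ∣ ≡ 1) → length (nonUnits ds) ℕ.≤ p
nonUnits-length zero    p ds       len unit = subst (ℕ._≤ p) (sym (length-map ∣_∣ (filter _ ds)))
  (ℕ.≤-trans (length-filter _ ds) (ℕ.≤-reflexive len))
nonUnits-length (suc q) p (d ∷ ds) len unit = subst (λ l → length l ℕ.≤ p) (sym (nonUnits-unit d ds (unit zero (s≤s z≤n))))
  (nonUnits-length q p ds (ℕ.suc-injective len) (λ k lt → unit (suc k) (s≤s lt)))

-- Powers of y+z and the binomial matrix.

binomℤ-neg : ∀ N {t} → t ℤ.< + 0 → binomℤ N t ≡ + 0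
binomℤ-neg N {+ t}      (ℤ.+<+ ())
binomℤ-neg N { -[1+ t ]} _ = refl

binomℤ-large : ∀ N {t} → + N ℤ.< t → binomℤ N t ≡ + 0
binomℤ-large N (ℤ.+<+ N<t) = cong +_ (k>n⇒nCk≡0 N<t)

binomℤ-pascal : ∀ N t → binomℤ (suc N) t ≡ binomℤ N t ℤ.+ binomℤ N (ℤ.pred t)
binomℤ-pascal N (+ zero)   = refl
binomℤ-pascal N (+ suc t)  = cong +_ (trans (sym (nCk+nC[k+1]≡[n+1]C[k+1] N t)) (ℕ.+-comm (binom N t) _))
binomℤ-pascal N -[1+ t ]   = refl

sgn : ℕ → ℤ
sgn zero    = + 1
sgn (suc N) = ℤ.- sgn N

∣sgn∣ : ∀ N → ∣ sgn N ∣ ≡ 1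
∣sgn∣ zero    = refl
∣sgn∣ (suc N) = trans (ℤ.∣-i∣≡∣i∣ (sgn N)) (∣sgn∣ N)

module _ (D : ℕ) (g : ℕ → ℕ → ℤ) where
  open ≡.≡-Reasoning

  antidiagonal : Fin (suc D) → ℤ
  antidiagonal c = g (D ℕ.∸ toℕ c) (toℕ c)

  binomRow : ℕ → ℤ → Fin (suc D) → ℤ
  binomRow N t c = binomℤ N (t ℤ.- + toℕ c)

  binomRow-pascal : ∀ N t → binomRow (suc N) t ⋆ antidiagonal ≡
    (binomRow N t ⋆ antidiagonal) ℤ.+ (binomRow N (ℤ.pred t) ⋆ antidiagonal)
  binomRow-pascal N t = trans
    (∑-cong (λ c → trans (cong (ℤ._* antidiagonal c) (step c)) (ℤ.*-distribʳ-+ (antidiagonal c) (binomRow N t c) (binomRow N (ℤ.pred t) c))))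
    (∑-+ (λ c → binomRow N t c ℤ.* antidiagonal c) (λ c → binomRow N (ℤ.pred t) c ℤ.* antidiagonal c))
    where
    step : ∀ c → binomRow (suc N) t c ≡ binomRow N t c ℤ.+ binomRow N (ℤ.pred t) c
    step c = trans (binomℤ-pascal N (t ℤ.- + toℕ c))
      (cong (λ x → binomRow N t c ℤ.+ binomℤ N x) (sym (ℤ.+-assoc (ℤ.- + 1) t (ℤ.- + toℕ c))))

  ⋆-zeroRow : ∀ u → (∀ c → u c ≡ + 0) → u ⋆ antidiagonal ≡ + 0
  ⋆-zeroRow u u≡0 = ∑-zero (λ c → cong (ℤ._* antidiagonal c) (u≡0 c))

  -- The binomial theorem for (-(y+z))^N g, by induction on N with Pascal's rule: the y-shift gives
  -- the row at k, the z-shift the row at k-1.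
  negMulYZ^-binom : ∀ N j k → j ℕ.+ k ≡ N ℕ.+ D →
    negMulYZ^ N g j k ≡ sgn N ℤ.* (binomRow N (+ k) ⋆ antidiagonal)
  negMulYZ^-binom zero j k j+k≡D = sym (begin
    + 1 ℤ.* (binomRow 0 (+ k) ⋆ antidiagonal)  ≡⟨ ℤ.*-identityˡ _ ⟩
    binomRow 0 (+ k) ⋆ antidiagonal            ≡⟨ ∑-single c₀ {λ c → binomRow 0 (+ k) c ℤ.* antidiagonal c} off ⟩
    binomRow 0 (+ k) c₀ ℤ.* antidiagonal c₀    ≡⟨ cong₂ (λ x y → binomℤ 0 x ℤ.* y) (trans (cong (λ c → + k ℤ.- + c) c₀≡k) (ℤ.+-inverseʳ (+ k)))
                                                    (trans (cong (λ c → g (D ℕ.∸ c) c) c₀≡k) (cong (λ j → g j k) (trans (cong (ℕ._∸ k) (sym j+k≡D)) (ℕ.m+n∸n≡m j k)))) ⟩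
    + 1 ℤ.* g j k                              ≡⟨ ℤ.*-identityˡ _ ⟩
    g j k                                      ∎)
    where
    k<1+D : k ℕ.< suc D
    k<1+D = s≤s (ℕ.≤-trans (ℕ.m≤n+m k j) (ℕ.≤-reflexive j+k≡D))
    c₀ = fromℕ< k<1+D
    c₀≡k : toℕ c₀ ≡ k
    c₀≡k = toℕ-fromℕ< k<1+D
    binom0 : ∀ t → t ≢ + 0 → binomℤ 0 t ≡ + 0
    binom0 (+ zero)   t≢0 = contradiction refl t≢0
    binom0 (+ suc t)  _   = refl
    binom0 -[1+ t ]   _   = refl
    off : ∀ c → c ≢ c₀ → binomRow 0 (+ k) c ℤ.* antidiagonal c ≡ + 0
    off c c≢c₀ = cong (ℤ._* antidiagonal c) (binom0 _ λ eq →
      c≢c₀ (toℕ-injective (trans (sym (ℤ.+-injective (ℤ.i-j≡0⇒i≡j (+ k) (+ toℕ c) eq))) (sym c₀≡k))))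
  negMulYZ^-binom (suc N) j k j+k≡ = begin
    ℤ.- (shift (+ 0) (λ j′ → negMulYZ^ N g j′ k) j ℤ.+ shift (+ 0) (negMulYZ^ N g j) k)
      ≡⟨ cong₂ (λ x y → ℤ.- (x ℤ.+ y)) (shiftʸ j j+k≡) (shiftᶻ k j+k≡) ⟩
    ℤ.- (sgn N ℤ.* (binomRow N (+ k) ⋆ antidiagonal) ℤ.+ sgn N ℤ.* (binomRow N (ℤ.pred (+ k)) ⋆ antidiagonal))
      ≡⟨ cong ℤ.-_ (ℤ.*-distribˡ-+ (sgn N) (binomRow N (+ k) ⋆ antidiagonal) (binomRow N (ℤ.pred (+ k)) ⋆ antidiagonal)) ⟨
    ℤ.- (sgn N ℤ.* ((binomRow N (+ k) ⋆ antidiagonal) ℤ.+ (binomRow N (ℤ.pred (+ k)) ⋆ antidiagonal)))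
      ≡⟨ cong (λ x → ℤ.- (sgn N ℤ.* x)) (binomRow-pascal N (+ k)) ⟨
    ℤ.- (sgn N ℤ.* (binomRow (suc N) (+ k) ⋆ antidiagonal))
      ≡⟨ ℤ.neg-distribˡ-* (sgn N) _ ⟩
    ℤ.- sgn N ℤ.* (binomRow (suc N) (+ k) ⋆ antidiagonal) ∎
    where
    shiftʸ : ∀ j → j ℕ.+ k ≡ suc N ℕ.+ D →
      shift (+ 0) (λ j′ → negMulYZ^ N g j′ k) j ≡ sgn N ℤ.* (binomRow N (+ k) ⋆ antidiagonal)
    shiftʸ (suc j) eq = negMulYZ^-binom N j k (ℕ.suc-injective eq)
    -- With j = 0 one has k = N+1+D, so k-c exceeds N for every c ≤ D and all binomials vanish.
    shiftʸ zero    eq = sym (trans (cong (sgn N ℤ.*_) (⋆-zeroRow (binomRow N (+ k)) λ c → binomℤ-large N (N<k-c c))) (ℤ.*-zeroʳ (sgn N)))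
      where
      N<k-c : ∀ (c : Fin (suc D)) → + N ℤ.< + k ℤ.- + toℕ c
      N<k-c c = subst (+ N ℤ.<_) (sym (trans (ℤ.m-n≡m⊖n k (toℕ c)) (ℤ.⊖-≥ c≤k))) (ℤ.+<+ (ℕ.m+n≤o⇒m≤o∸n (suc N)
        (ℕ.≤-trans (ℕ.+-monoʳ-≤ (suc N) c≤D) (ℕ.≤-reflexive (sym eq)))))
        where
        c≤D : toℕ c ℕ.≤ D
        c≤D = toℕ≤pred[n] c
        c≤k : toℕ c ℕ.≤ k
        c≤k = ℕ.≤-trans c≤D (ℕ.≤-trans (ℕ.m≤n+m D (suc N)) (ℕ.≤-reflexive (sym eq)))
    shiftᶻ : ∀ k → j ℕ.+ k ≡ suc N ℕ.+ D →
      shift (+ 0) (negMulYZ^ N g j) k ≡ sgn N ℤ.* (binomRow N (ℤ.pred (+ k)) ⋆ antidiagonal)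
    shiftᶻ (suc k) eq = negMulYZ^-binom N j k (ℕ.suc-injective (trans (sym (ℕ.+-suc j k)) eq))
    shiftᶻ zero    eq = sym (trans (cong (sgn N ℤ.*_) (⋆-zeroRow (binomRow N ℤ.-1ℤ) λ c → binomℤ-neg N (neg (toℕ c)))) (ℤ.*-zeroʳ (sgn N)))
      where
      neg : ∀ c → ℤ.-1ℤ ℤ.- + c ℤ.< + 0
      neg zero    = ℤ.-<+
      neg (suc c) = ℤ.-<+

-- Vanishing conditions on consecutive Smith coordinates.

entry : ∀ {a} {X : Set a} → X → ∀ {n} → (Fin n → X) → ℕ → X
entry o {zero}  v _       = o
entry o {suc n} v zero    = v zero
entry o {suc n} v (suc i) = entry o (v ∘ suc) i

entry-toℕ : ∀ {a} {X : Set a} (o : X) {n} (v : Fin n → X) b → entry o v (toℕ b) ≡ v b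
entry-toℕ o v zero    = refl
entry-toℕ o v (suc b) = entry-toℕ o (v ∘ suc) b

≡0⇒∣ : ∀ {d x} → x ≡ + 0 → d ∣ x
≡0⇒∣ refl = divides (+ 0) refl

-- Moves sums between index sets whose sizes agree only propositionally, such as n′ and D+1.
∑-toℕ : ∀ {m n} (f : ℕ → ℤ) → m ≡ n → ∑ {m} (f ∘ toℕ) ≡ ∑ {n} (f ∘ toℕ)
∑-toℕ f refl = refl

-- An index past the last row yields the zero row, a trivial condition, so the length is always
-- `len`.
rowsFrom : ∀ {m n} → Matrix ℤ m n → ℕ → ℕ → List (Fin n → ℤ)
rowsFrom Q s len = applyUpTo (λ i → entry (λ _ → + 0) Q (s ℕ.+ i)) len

length-rowsFrom : ∀ {m n} (Q : Matrix ℤ m n) s len → length (rowsFrom Q s len) ≡ len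
length-rowsFrom Q s len = length-applyUpTo _ len

module _ {m n} (Q : Matrix ℤ m n) {w : Fin n → ℤ} where

  rowsFrom-vanish : ∀ s len → All (λ u → u ⋆ w ≡ + 0) (rowsFrom Q s len) →
    ∀ b → s ℕ.≤ toℕ b → toℕ b ℕ.< s ℕ.+ len → Q b ⋆ w ≡ + 0
  rowsFrom-vanish s len zeros b s≤b b<s+len = subst (λ u → u ⋆ w ≡ + 0)
    (trans (cong (entry _ Q) (ℕ.m+[n∸m]≡n s≤b)) (entry-toℕ _ Q b))
    (All.applyUpTo⁻ _ len zeros (ℕ.+-cancelˡ-< s _ _ (subst (ℕ._< s ℕ.+ len) (sym (ℕ.m+[n∸m]≡n s≤b)) b<s+len)))

  -- A coordinate before `s` is 0; from `s` on, its diagonal entry is a multiple of `nth ds s`.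
  coords-below : ∀ {ds} → Linked ℤᵤ._∣_ ds → ∀ s → All (λ u → u ⋆ w ≡ + 0) (rowsFrom Q 0 s) →
    ∀ b → nth ds s ∣ nth ds (toℕ b) ℤ.* (Q b ⋆ w)
  coords-below {ds} chain s zeros b with toℕ b ℕ.<? s
  ... | yes b<s = ℤ.∣n⇒∣m*n (nth ds (toℕ b)) (≡0⇒∣ (rowsFrom-vanish 0 s zeros b z≤n b<s))
  ... | no  b≮s = ℤ.∣m⇒∣m*n (Q b ⋆ w) (nth-chain chain (ℕ.≮⇒≥ b≮s))

  -- A coordinate after `s` is 0; up to `s`, its diagonal entry divides `nth ds s`.
  coords-above : ∀ {ds} → Linked ℤᵤ._∣_ ds → ∀ s → All (λ u → u ⋆ w ≡ + 0) (rowsFrom Q (suc s) (m ℕ.∸ suc s)) →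
    ∀ {d} → (∀ b → d ∣ nth ds (toℕ b) ℤ.* (Q b ⋆ w)) → ∀ b → d ∣ nth ds s ℤ.* (Q b ⋆ w)
  coords-above {ds} chain s zeros {d} h b with toℕ b ℕ.≤? s
  ... | yes b≤s = ℤ.∣-trans (h b) (ℤ.*-monoˡ-∣ (Q b ⋆ w) (nth-chain chain b≤s))
  ... | no  b≰s = ℤ.∣n⇒∣m*n (nth ds s) (≡0⇒∣ vanish)
    where
    s<b = ℕ.≰⇒> b≰s
    vanish : Q b ⋆ w ≡ + 0
    vanish = rowsFrom-vanish (suc s) (m ℕ.∸ suc s) zeros b s<b
      (subst (toℕ b ℕ.<_) (sym (ℕ.m+[n∸m]≡n (ℕ.≤-trans s<b (ℕ.<⇒≤ (toℕ<n b))))) (toℕ<n b))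

-- Comparison of the Smith entries of `U` and `M`, and the nullity bound.

module Invariants (A₀ B C r D : ℕ) (A₀+D≡r : A₀ ℕ.+ D ≡ r) (C≤B : C ℕ.≤ B) (B≤A : B ℕ.≤ suc A₀)
                  (2r+4≤A+B+C : 2 ℕ.* r ℕ.+ 4 ℕ.≤ suc A₀ ℕ.+ B ℕ.+ C) where

  open Setup A₀ B C r D A₀+D≡r C≤B B≤A 2r+4≤A+B+C
  open Over ℤ.+-*-commutativeRing

  Uᵣ : Matrix ℤ m n
  Uᵣ = U A B C r

  Mᵣ : Matrix ℤ m′ n′
  Mᵣ = M A B C r

  top : (Fin n → ℤ) → Fin n′ → ℤ
  top w c = topRow (toℕ c) ⋆ w

  -- Row i of M belongs to the monomial y^j z^k of degree r+1 with j = B-1-i.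
  M-row : ∀ w (i : Fin m′) {j k} → toℕ i ℕ.+ suc j ≡ B → j ℕ.+ k ≡ suc r →
    negMulYZ^ A (ser w A₀) j k ≡ sgn A ℤ.* (Mᵣ i ⋆ top w)
  M-row w i {j} {k} i+j j+k = trans
    (negMulYZ^-binom D (ser w A₀) A j k (trans j+k (cong suc (sym A₀+D≡r))))
    (cong (sgn A ℤ.*_) (sym (trans
      (∑-cong (λ c → cong (λ x → binomℤ A x ℤ.* top w c) (arg (toℕ c))))
      (∑-toℕ (λ c → binomℤ A (+ k ℤ.- + c) ℤ.* (topRow c ⋆ w)) n′≡1+D))))
    where
    open ≡.≡-Reasoning
    r+2+i≡B+k : r ℕ.+ 2 ℕ.+ toℕ i ≡ B ℕ.+ k
    r+2+i≡B+k = begin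
      r ℕ.+ 2 ℕ.+ toℕ i         ≡⟨ solve 2 (λ r i → r :+ con 2 :+ i := con 1 :+ (con 1 :+ r) :+ i) refl r (toℕ i) ⟩
      suc (suc r) ℕ.+ toℕ i     ≡⟨ cong (λ x → suc x ℕ.+ toℕ i) j+k ⟨
      suc (j ℕ.+ k) ℕ.+ toℕ i   ≡⟨ solve 3 (λ i j k → con 1 :+ (j :+ k) :+ i := i :+ (con 1 :+ j) :+ k) refl (toℕ i) j k ⟩
      toℕ i ℕ.+ suc j ℕ.+ k     ≡⟨ cong (ℕ._+ k) i+j ⟩
      B ℕ.+ k                   ∎
    arg : ∀ c → + (r ℕ.+ 2 ℕ.+ toℕ i) ℤ.- + (B ℕ.+ c) ≡ + k ℤ.- + c
    arg c = begin
      + (r ℕ.+ 2 ℕ.+ toℕ i) ℤ.- + (B ℕ.+ c)  ≡⟨ cong (λ x → + x ℤ.- + (B ℕ.+ c)) r+2+i≡B+k ⟩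
      + (B ℕ.+ k) ℤ.- + (B ℕ.+ c)            ≡⟨ ℤ.m-n≡m⊖n (B ℕ.+ k) (B ℕ.+ c) ⟩
      (B ℕ.+ k) ℤ.⊖ (B ℕ.+ c)                ≡⟨ ℤ.+-cancelˡ-⊖ B k c ⟩
      k ℤ.⊖ c                                ≡⟨ ℤ.m-n≡m⊖n k c ⟨
      + k ℤ.- + c                            ∎

  sgn-cancel : ∀ {d x} N → d ∣ sgn N ℤ.* x → d ∣ x
  sgn-cancel {d} {x} N d∣ = ∣ᵤ⇒∣ (subst (∣ d ∣ ℕ.∣_)
    (trans (ℤ.∣i*j∣≡∣i∣*∣j∣ (sgn N) x) (trans (cong (ℕ._* ∣ x ∣) (∣sgn∣ N)) (ℕ.*-identityˡ ∣ x ∣))) (∣⇒∣ᵤ d∣))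

  module _ (d : ℤ) (w : Fin n → ℤ) (interior : ∀ {t} → t ∈ interiorPts → d ∣ stepRow (raise t) ⋆ w) where

    -- Modulo d, once the interior conditions hold, the x⁰ rows of `U` act on w as rows of `M` act
    -- on the top slice, up to sign.
    bottom-∣ : ∀ (i : Fin m′) {j k} → toℕ i ℕ.+ suc j ≡ B → j ℕ.+ k ≡ suc r → j ℕ.< B → k ℕ.< C →
      d ∣ (stepRow (0 , j , k) ⋆ w) ℤ.+ sgn A ℤ.* (Mᵣ i ⋆ top w)
    bottom-∣ i {j} {k} i+j j+k j<B k<C = subst (d ∣_)
      (cong₂ ℤ._+_ (sym (mulStep-⋆ (basis A B C r) w 0 j k)) (M-row w i i+j j+k))
      (bottom (multiples d) B C A₀ r (ser w) (interior-mem (multiples d) w interior) j k j<B k<C j+k)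

    M-∣⇒U-∣ : (∀ i → d ∣ Mᵣ i ⋆ top w) → ∀ a → d ∣ Uᵣ a ⋆ w
    M-∣⇒U-∣ h a = U-row (basis A B C (suc r) a) (∈-lookup {xs = monos A B C (suc r)} a)
      where
      U-row : ∀ t → t ∈ monos A B C (suc r) → d ∣ stepRow t ⋆ w
      U-row (suc i , j , k) t∈ with ∈-monos⁻ A B C (suc r) t∈
      ... | i<A , j<B , k<C , eq = interior (∈-filter⁺ _
        (∈-monos⁺ A B C r (ℕ.<⇒≤ i<A) j<B k<C (ℕ.suc-injective eq)) (ℕ.≤-pred i<A))
      U-row (zero , j , k) t∈ with ∈-monos⁻ A B C (suc r) t∈
      ... | _ , j<B , k<C , j+k = ℤ.∣m+n∣n⇒∣m (bottom-∣ i (trans (cong (ℕ._+ suc j) (toℕ-fromℕ< i<m′)) i+j) j+k j<B k<C)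
              (ℤ.∣n⇒∣m*n (sgn A) (h i))
        where
        open ℕ.≤-Reasoning
        i₀ = B ℕ.∸ suc j
        i+j : i₀ ℕ.+ suc j ≡ B
        i+j = ℕ.m∸n+n≡m j<B
        -- Since j + k = r+1, the bound B-1-j < B+C-r-2 amounts to k < C.
        i<m′ : i₀ ℕ.< m′
        i<m′ = ℕ.m+n≤o⇒m≤o∸n (suc i₀) (begin
          suc i₀ ℕ.+ (r ℕ.+ 2)       ≡⟨ solve 2 (λ i r → con 1 :+ i :+ (r :+ con 2) := i :+ (con 2 :+ (con 1 :+ r))) refl i₀ r ⟩
          i₀ ℕ.+ (2 ℕ.+ suc r)       ≡⟨ cong (λ x → i₀ ℕ.+ (2 ℕ.+ x)) j+k ⟨
          i₀ ℕ.+ (2 ℕ.+ (j ℕ.+ k))   ≡⟨ solve 3 (λ i j k → i :+ (con 2 :+ (j :+ k)) := i :+ (con 1 :+ j) :+ (con 1 :+ k)) refl i₀ j k ⟩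
          i₀ ℕ.+ suc j ℕ.+ suc k     ≡⟨ cong (ℕ._+ suc k) i+j ⟩
          B ℕ.+ suc k                ≤⟨ ℕ.+-monoʳ-≤ B k<C ⟩
          B ℕ.+ C                    ∎)
        i = fromℕ< i<m′

  U-∣⇒M-∣ : ∀ d w → (∀ a → d ∣ Uᵣ a ⋆ w) → ∀ i → d ∣ Mᵣ i ⋆ top w
  U-∣⇒M-∣ d w h i = sgn-cancel A (ℤ.∣m+n∣m⇒∣n
    (bottom-∣ d w (image-mem (multiples d) w h ∘ raise∈) i i+j j+k j<B k<C)
    (image-mem (multiples d) w h (∈-monos⁺ A B C (suc r) (s≤s z≤n) j<B k<C j+k)))
    where
    open ℕ.≤-Reasoning
    i₀ = toℕ i
    1+i+r+2≤B+C : suc i₀ ℕ.+ (r ℕ.+ 2) ℕ.≤ B ℕ.+ C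
    1+i+r+2≤B+C = ℕ.≤-trans (ℕ.+-monoˡ-≤ (r ℕ.+ 2) (toℕ<n i)) (ℕ.≤-reflexive (ℕ.m∸n+n≡m r+2≤B+C))
      where
      r+2≤B+C : r ℕ.+ 2 ℕ.≤ B ℕ.+ C
      r+2≤B+C = ℕ.≤-trans (ℕ.m≤m+n (r ℕ.+ 2) D) (ℕ.<⇒≤ r+2+D<B+C)
    -- From i₀ + r + 2 < B + C and C ≤ B ≤ r + 2.
    i<B : i₀ ℕ.< B
    i<B = ℕ.+-cancelʳ-≤ C _ _ (ℕ.≤-trans (ℕ.+-monoʳ-≤ (suc i₀) (ℕ.≤-trans C≤B B≤r+2)) 1+i+r+2≤B+C)
    j = B ℕ.∸ suc i₀
    k = r ℕ.+ 2 ℕ.∸ B ℕ.+ i₀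
    1+i+j : suc i₀ ℕ.+ j ≡ B
    1+i+j = ℕ.m+[n∸m]≡n i<B
    i+j : i₀ ℕ.+ suc j ≡ B
    i+j = trans (ℕ.+-suc i₀ j) 1+i+j
    B+k : B ℕ.+ k ≡ r ℕ.+ 2 ℕ.+ i₀
    B+k = trans (sym (ℕ.+-assoc B _ i₀)) (cong (ℕ._+ i₀) (ℕ.m+[n∸m]≡n B≤r+2))
    j<B : j ℕ.< B
    j<B = ℕ.≤-trans (s≤s (ℕ.m≤n+m j i₀)) (ℕ.≤-reflexive 1+i+j)
    k<C : k ℕ.< C
    k<C = ℕ.+-cancelˡ-< B _ _ (begin-strict
      B ℕ.+ k                 ≡⟨ B+k ⟩
      r ℕ.+ 2 ℕ.+ i₀          <⟨ ℕ.≤-reflexive (solve 2 (λ r i → con 1 :+ (r :+ con 2 :+ i) := con 1 :+ i :+ (r :+ con 2)) refl r i₀) ⟩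
      suc i₀ ℕ.+ (r ℕ.+ 2)    ≤⟨ 1+i+r+2≤B+C ⟩
      B ℕ.+ C                 ∎)
    j+k : j ℕ.+ k ≡ suc r
    j+k = ℕ.+-cancelˡ-≡ (suc i₀) _ _ (begin-equality
      suc i₀ ℕ.+ (j ℕ.+ k)    ≡⟨ ℕ.+-assoc (suc i₀) j k ⟨
      suc i₀ ℕ.+ j ℕ.+ k      ≡⟨ cong (ℕ._+ k) 1+i+j ⟩
      B ℕ.+ k                 ≡⟨ B+k ⟩
      r ℕ.+ 2 ℕ.+ i₀          ≡⟨ solve 2 (λ r i → r :+ con 2 :+ i := con 1 :+ i :+ (con 1 :+ r)) refl r i₀ ⟩
      suc i₀ ℕ.+ suc r        ∎)

  module _ {ds} (snf : IsSNF Uᵣ ds) where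
    open Diagonalisation (diagonalise n≤m snf)

    chain : Linked ℤᵤ._∣_ ds
    chain = proj₁ (proj₂ snf)

    length-ds : length ds ≡ q ℕ.+ n′
    length-ds = trans (proj₁ snf) (trans (ℕ.m≥n⇒m⊓n≡n n≤m) n≡q+n′)

    -- Kill the first k Smith coordinates and the n′ top coefficients of a primitive w. Then d
    -- divides Uw and the top slice is 0, so d divides w. Decidability of divisibility removes the
    -- double negation.
    leading-∣1 : ∀ k → k ℕ.< q → nth ds k ∣ + 1
    leading-∣1 k k<q = decidable-stable (d ℤ.∣? + 1) λ d∤1 →
      ¬¬-primitiveKernel rows rows<n λ { (w , w-primitive , zeros) → d∤1 (w-primitive (+ 1) λ b →
        subst (d ∣_) (sym (ℤ.*-identityˡ (w b))) (determine (multiples d) w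
          (coords⇒image d w (coords-below coords chain k (All.++⁻ˡ coordRows zeros)))
          (λ c c<n′ → ≡0⇒∣ (All.applyUpTo⁻ topRow n′ (All.++⁻ʳ coordRows zeros) c<n′)) b)) }
      where
      d = nth ds k
      coordRows = rowsFrom coords 0 k
      rows = coordRows ++ applyUpTo topRow n′
      rows<n : length rows ℕ.< n
      rows<n = begin-strict
        length rows                                    ≡⟨ length-++ coordRows ⟩
        length coordRows ℕ.+ length (applyUpTo topRow n′) ≡⟨ cong₂ ℕ._+_ (length-rowsFrom coords 0 k) (length-applyUpTo topRow n′) ⟩
        k ℕ.+ n′                                       <⟨ ℕ.+-monoˡ-< n′ k<q ⟩
        q ℕ.+ n′                                       ≡⟨ n≡q+n′ ⟨
        n                                              ∎
        where open ℕ.≤-Reasoning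

    leading-units : ∀ k → k ℕ.< q → ∣ nth ds k ∣ ≡ 1
    leading-units k k<q = ℕ.∣1⇒≡1 (∣⇒∣ᵤ (leading-∣1 k k<q))

    module _ {ds′} (snf′ : IsSNF Mᵣ ds′) where
      open Diagonalisation (diagonalise n′≤m′ snf′) using () renaming
        (coords to coords′; image⇒coords to image⇒coords′; coords⇒image to coords⇒image′; reconstruct to reconstruct′)

      chain′ : Linked ℤᵤ._∣_ ds′
      chain′ = proj₁ (proj₂ snf′)

      length-ds′ : length ds′ ≡ n′
      length-ds′ = trans (proj₁ snf′) (ℕ.m≥n⇒m⊓n≡n n′≤m′)

      -- The Smith coordinates of `M` pulled back along `top` to linear forms on ℤⁿ.
      topCoords : Matrix ℤ n′ n
      topCoords c b = coords′ c ⋆ (λ x → topRow (toℕ x) b)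

      topCoords-⋆ : ∀ w c → topCoords c ⋆ w ≡ coords′ c ⋆ top w
      topCoords-⋆ w c = ⋆-assoc (coords′ c) (λ x → topRow (toℕ x)) w

      -- The q+k Smith coordinates of `U` before d and the n′-k-1 coordinates of `M` after e are set
      -- to 0, which is n-1 conditions. Then d divides Uw, hence M applied to the top slice, hence e
      -- times the top slice.
      U-∣-M : ∀ k → k ℕ.< n′ → nth ds (q ℕ.+ k) ∣ nth ds′ k
      U-∣-M k k<n′ = decidable-stable (d ℤ.∣? e) λ d∤e →
        ¬¬-primitiveKernel rows rows<n λ { (w , w-primitive , zeros) →
          d∤e (w-primitive e (d∣ew w (All.++⁻ˡ coordRows zeros) (All.++⁻ʳ coordRows zeros))) }
        where
        d = nth ds (q ℕ.+ k)
        e = nth ds′ k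
        coordRows = rowsFrom coords 0 (q ℕ.+ k)
        rows = coordRows ++ rowsFrom topCoords (suc k) (n′ ℕ.∸ suc k)
        rows<n : length rows ℕ.< n
        rows<n = begin-strict
          length rows
            ≡⟨ length-++ coordRows ⟩
          length coordRows ℕ.+ length (rowsFrom topCoords (suc k) (n′ ℕ.∸ suc k))
            ≡⟨ cong₂ ℕ._+_ (length-rowsFrom coords 0 (q ℕ.+ k)) (length-rowsFrom topCoords (suc k) (n′ ℕ.∸ suc k)) ⟩
          q ℕ.+ k ℕ.+ (n′ ℕ.∸ suc k)    ≡⟨ ℕ.+-assoc q k _ ⟩
          q ℕ.+ (k ℕ.+ (n′ ℕ.∸ suc k))  <⟨ ℕ.+-monoʳ-< q (ℕ.≤-reflexive (ℕ.m+[n∸m]≡n k<n′)) ⟩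
          q ℕ.+ n′                      ≡⟨ n≡q+n′ ⟨
          n                             ∎
          where open ℕ.≤-Reasoning
        d∣ew : ∀ w → All (λ u → u ⋆ w ≡ + 0) coordRows →
          All (λ u → u ⋆ w ≡ + 0) (rowsFrom topCoords (suc k) (n′ ℕ.∸ suc k)) → ∀ b → d ∣ e ℤ.* w b
        -- Only e times the top slice is known to be divisible by d, so `determine` is applied to e
        -- w.
        d∣ew w below above = determine (multiples d) (λ b → e ℤ.* w b)
          (λ a → subst (d ∣_) (sym (⋆-scaleʳ (Uᵣ a) e w)) (ℤ.∣n⇒∣m*n e (d∣Uw a)))
          (λ c c<n′ → subst (d ∣_) (sym (⋆-scaleʳ (topRow c) e w))
            (subst (λ x → d ∣ e ℤ.* (topRow x ⋆ w)) (toℕ-fromℕ< c<n′) (d∣e-top (fromℕ< c<n′))))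
          where
          d∣Uw : ∀ a → d ∣ Uᵣ a ⋆ w
          d∣Uw = coords⇒image d w (coords-below coords chain (q ℕ.+ k) below)
          d∣e-top : ∀ c → d ∣ e ℤ.* top w c
          d∣e-top = reconstruct′ d e (top w) λ c → subst (λ x → d ∣ e ℤ.* x) (topCoords-⋆ w c)
            (coords-above topCoords chain′ k above (λ c → subst (λ x → d ∣ nth ds′ (toℕ c) ℤ.* x) (sym (topCoords-⋆ w c))
              (image⇒coords′ d (top w) (U-∣⇒M-∣ d w d∣Uw) c)) c)

      -- The n-1 conditions are the q interior ones, the k coordinates of `M` before d and the
      -- coordinates of `U` after e. Then d divides M applied to the top slice, hence Uw, hence e w.
      M-∣-U : ∀ k → k ℕ.< n′ → nth ds′ k ∣ nth ds (q ℕ.+ k)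
      M-∣-U k k<n′ = decidable-stable (d ℤ.∣? e) λ d∤e →
        ¬¬-primitiveKernel rows rows<n λ { (w , w-primitive , zeros) →
          d∤e (w-primitive e (d∣ew w (All.++⁻ˡ interiorRows zeros)
            (All.++⁻ˡ topCoordRows (All.++⁻ʳ interiorRows zeros)) (All.++⁻ʳ topCoordRows (All.++⁻ʳ interiorRows zeros)))) }
        where
        d = nth ds′ k
        e = nth ds (q ℕ.+ k)
        interiorRows = map (stepRow ∘ raise) interiorPts
        topCoordRows = rowsFrom topCoords 0 k
        rest = n ℕ.∸ suc (q ℕ.+ k)
        rows = interiorRows ++ topCoordRows ++ rowsFrom coords (suc (q ℕ.+ k)) rest
        rows<n : length rows ℕ.< n
        rows<n = begin-strict
          length rows
            ≡⟨ trans (length-++ interiorRows) (cong (length interiorRows ℕ.+_) (length-++ topCoordRows)) ⟩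
          length interiorRows ℕ.+ (length topCoordRows ℕ.+ length (rowsFrom coords (suc (q ℕ.+ k)) rest))
            ≡⟨ cong₂ ℕ._+_ (length-map (stepRow ∘ raise) interiorPts)
                 (cong₂ ℕ._+_ (length-rowsFrom topCoords 0 k) (length-rowsFrom coords (suc (q ℕ.+ k)) rest)) ⟩
          q ℕ.+ (k ℕ.+ rest)    ≡⟨ ℕ.+-assoc q k rest ⟨
          q ℕ.+ k ℕ.+ rest      <⟨ ℕ.≤-reflexive (ℕ.m+[n∸m]≡n q+k<n) ⟩
          n                     ∎
          where
          open ℕ.≤-Reasoning
          q+k<n : q ℕ.+ k ℕ.< n
          q+k<n = subst (q ℕ.+ k ℕ.<_) (sym n≡q+n′) (ℕ.+-monoʳ-< q k<n′)
        d∣ew : ∀ w → All (λ u → u ⋆ w ≡ + 0) interiorRows → All (λ u → u ⋆ w ≡ + 0) topCoordRows →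
          All (λ u → u ⋆ w ≡ + 0) (rowsFrom coords (suc (q ℕ.+ k)) rest) → ∀ b → d ∣ e ℤ.* w b
        d∣ew w interior below above = reconstruct d e w (coords-above coords chain (q ℕ.+ k) above
          (image⇒coords d w (M-∣⇒U-∣ d w (λ t∈ → ≡0⇒∣ (All.lookup (All.map⁻ interior) t∈))
            (coords⇒image′ d (top w) λ c → subst (λ x → d ∣ nth ds′ (toℕ c) ℤ.* x) (topCoords-⋆ w c)
              (coords-below topCoords chain′ k below c)))))

      nonUnits-agree : nonUnits ds ≡ nonUnits ds′
      nonUnits-agree = nonUnits-≡ q ds ds′ (trans length-ds (cong (q ℕ.+_) (sym length-ds′))) leading-units
        λ k k<len → let k<n′ = subst (k ℕ.<_) length-ds′ k<len in
          ℕ.∣-antisym (∣⇒∣ᵤ (U-∣-M k k<n′)) (∣⇒∣ᵤ (M-∣-U k k<n′))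

    nonUnits-few : length (nonUnits ds) ℕ.≤ n′
    nonUnits-few = nonUnits-length q n′ ds length-ds leading-units

  -- With more than n′ vectors in the kernel, some nontrivial combination has top slice 0. By
  -- `determine` for the zero ideal it vanishes, against independence.
  nullity : ∀ {c ℓ} (K : Field c ℓ) → NullityAtMost K (UK K A B C r) n′
  nullity K s v Uv≈0 independent = decidable-stable (s ℕ.≤? n′) λ s≰n′ →
    KLA.Kernel.¬¬-kernel 0≉1 noZeroDivisors rows
      (subst (ℕ._< s) (sym (length-applyUpTo row n′)) (ℕ.≰⇒> s≰n′))
      λ { (μ , (t , μt≉0) , zeros) → μt≉0 (independent μ (λ b → combination≈0 μ zeros b) t) }
    where
    open Field K hiding (zero; refl; sym; trans)
    open Field K using () renaming (sym to ≈-sym; trans to ≈-trans)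
    module KLA = LinearAlgebra commutativeRing
    module KU  = Over commutativeRing

    noZeroDivisors : ∀ {x y} → ¬ x ≈ 0# → ¬ y ≈ 0# → ¬ x * y ≈ 0#
    noZeroDivisors {x} {y} x≉0 y≉0 xy≈0 with inverse x x≉0
    ... | x⁻¹ , xx⁻¹≈1 = y≉0 (begin
      y              ≈⟨ *-identityˡ y ⟨
      1# * y         ≈⟨ *-congʳ xx⁻¹≈1 ⟨
      x * x⁻¹ * y    ≈⟨ *-congʳ (*-comm x x⁻¹) ⟩
      x⁻¹ * x * y    ≈⟨ *-assoc x⁻¹ x y ⟩
      x⁻¹ * (x * y)  ≈⟨ *-congˡ xy≈0 ⟩
      x⁻¹ * 0#       ≈⟨ zeroʳ x⁻¹ ⟩
      0#             ∎)
      where open import Relation.Binary.Reasoning.Setoid setoid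

    row : ℕ → Fin s → Carrier
    row c t = KU.topRow c KLA.⋆ v t

    rows = applyUpTo row n′

    combination : (Fin s → Carrier) → Fin n → Carrier
    combination μ b = μ KLA.⋆ (λ t → v t b)

    ⋆-combination : ∀ u μ → u KLA.⋆ combination μ ≈ (λ t → u KLA.⋆ v t) KLA.⋆ μ
    ⋆-combination u μ = ≈-trans
      (KLA.∑-cong (λ b → *-congˡ (KLA.∑-cong (λ t → *-comm (μ t) (v t b)))))
      (≈-sym (KLA.⋆-assoc u (λ b t → v t b) μ))

    combination≈0 : ∀ μ → All (λ u → u KLA.⋆ μ ≈ 0#) rows → ∀ b → combination μ b ≈ 0#
    combination≈0 μ zeros = KU.determine KLA.zeroIdeal (combination μ)
      (λ a → ≈-trans (⋆-combination (UK K A B C r a) μ)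
        (KLA.∑-zero (λ t → ≈-trans (*-congʳ (Uv≈0 t a)) (zeroˡ (μ t)))))
      (λ c c<n′ → ≈-trans (⋆-combination (KU.topRow c) μ) (All.applyUpTo⁻ row n′ zeros c<n′))

open import Data.Nat using (_+_; _*_; _∸_; _≤_)

theorem1p1 : ∀ {c ℓ : Level} (A B C r : ℕ) →
  1 ≤ C → C ≤ B → B ≤ A →
  A ≤ r + 1 → 2 * r + 4 ≤ A + B + C →
  (∀ ds ds′ → IsSNF (U A B C r) ds → IsSNF (M A B C r) ds′ →
     nonUnits ds ↭ nonUnits ds′)
  × (∀ ds → IsSNF (U A B C r) ds → length (nonUnits ds) ≤ r + 2 ∸ A)
  × ((K : Field c ℓ) → NullityAtMost K (UK K A B C r) (r + 2 ∸ A))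
theorem1p1 zero B C r 1≤C C≤B B≤A _ _ = contradiction (ℕ.≤-trans 1≤C (ℕ.≤-trans C≤B B≤A)) λ ()
theorem1p1 (suc A₀) B C r 1≤C C≤B B≤A A≤r+1 2r+4≤A+B+C =
  -- The lists of absolute values agree even in order, so the permutation comes from an equality.
  (λ ds ds′ snf snf′ → ↭-reflexive (nonUnits-agree snf snf′)) , (λ ds snf → nonUnits-few snf) , nullity
  where
  A₀≤r : A₀ ℕ.≤ r
  A₀≤r = ℕ.≤-pred (ℕ.≤-trans A≤r+1 (ℕ.≤-reflexive (ℕ.+-comm r 1)))
  open Invariants A₀ B C r (r ℕ.∸ A₀) (ℕ.m+[n∸m]≡n A₀≤r) C≤B B≤A 2r+4≤A+B+C
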